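{- Let $K_n$ be the complete graph on $n$ vertices. The eigenvalues, counted with multiplicity, of the resistance distance matrix of the cartesian product $K_n\times K_2$ are: $\frac{5n^2+2n-4}{n(n+2)}$ (once); $-\frac2n$ ($n-1$ times); $-1$ (once); and $-\frac{2}{n+2}$ ($n-1$ times).
   Context: For a connected graph $G$ with vertices $v_1,\dots,v_m$, Laplacian matrix $L$ (degree matrix minus adjacency matrix) and Moore-Penrose inverse $L^\dagger=(l^\dagger_{ij})$, the resistance distance is $r_{ij}=l^\dagger_{ii}+l^\dagger_{jj}-2l^\dagger_{ij}$, and the resistance distance matrix is $R(G)=(r_{ij})_{m\times m}$. The cartesian product $G_1\times G_2$ has vertex set $V(G_1)\times V(G_2)$, with $(v_1,u_1)$ and $(v_2,u_2)$ adjacent if $v_1=v_2$ and $u_1u_2\in E(G_2)$, or $u_1=u_2$ and $v_1v_2\in E(G_1)$. -}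

module Defs where

open import Algebra.Bundles using (RawRing)
import Algebra.Definitions.RawSemiring as RawSemiringDefinitions
open import Data.Bool using (if_then_else_)
open import Data.Fin using (Fin; zero; suc; toℕ; punchIn; remQuot)
import Data.Fin.Properties as Fin
open import Data.Integer using (+_)
open import Data.List using (List; []; _∷_; map; foldr; filter; length; allFin)
open import Data.Nat using (ℕ; zero; suc)
import Data.Nat as ℕ
open import Data.Product using (_×_; _,_)
open import Data.Rational using (ℚ; 0ℚ; 1ℚ; _+_; _*_; _-_; -_; _/_; +-*-rawRing)
open import Data.Sum using (_⊎_; inj₁; inj₂) renaming (map to ⊎-map)
open import Data.Vec.Functional using (Vector)
open import Function using (_∘_)
open import Level using (0ℓ)
open import Relation.Binary using (Rel; Symmetric; Irreflexive; Decidable)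
open import Relation.Binary.PropositionalEquality using (_≡_; _≢_; refl; sym)
open import Relation.Nullary using (does; ¬?; _×-dec_; _⊎-dec_)

record Graph (m : ℕ) : Set₁ where
  field
    Adj    : Rel (Fin m) 0ℓ
    adj?   : Decidable Adj
    symm   : Symmetric Adj
    irrefl : Irreflexive _≡_ Adj

open Graph

complete : ∀ n → Graph n
complete n = record
  { Adj    = _≢_
  ; adj?   = λ i j → ¬? (i Fin.≟ j)
  ; symm   = λ i≢j → i≢j ∘ sym
  ; irrefl = λ i≡j i≢j → i≢j i≡j
  }

-- The pairs in Fin m × Fin k are numbered by Fin (m * k) through the
-- bijection remQuot k.
infixr 7 _□_
_□_ : ∀ {m k} → Graph m → Graph k → Graph (m ℕ.* k)
_□_ {m} {k} G H = record
  { Adj    = λ i j → AdjPair (remQuot {m} k i) (remQuot {m} k j)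
  ; adj?   = λ i j → adjPair? (remQuot {m} k i) (remQuot {m} k j)
  ; symm   = ⊎-map (λ { (v≡v′ , e) → sym v≡v′ , symm H e })
                   (λ { (u≡u′ , e) → sym u≡u′ , symm G e })
  ; irrefl = λ { refl (inj₁ (_ , e)) → irrefl H refl e
               ; refl (inj₂ (_ , e)) → irrefl G refl e }
  }
  where
  AdjPair : Rel (Fin m × Fin k) 0ℓ
  AdjPair (v₁ , u₁) (v₂ , u₂) =
    (v₁ ≡ v₂ × Adj H u₁ u₂) ⊎ (u₁ ≡ u₂ × Adj G v₁ v₂)

  adjPair? : Decidable AdjPair
  adjPair? (v₁ , u₁) (v₂ , u₂) =
    ((v₁ Fin.≟ v₂) ×-dec adj? H u₁ u₂) ⊎-dec ((u₁ Fin.≟ u₂) ×-dec adj? G v₁ v₂)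

Matrix : Set → ℕ → ℕ → Set
Matrix A m n = Vector (Vector A n) m

private
  module ℚ-Sum = RawSemiringDefinitions (RawRing.rawSemiring +-*-rawRing)

infix 4 _≐_
_≐_ : ∀ {m n} → Rel (Matrix ℚ m n) 0ℓ
A ≐ B = ∀ i j → A i j ≡ B i j

infixl 7 _⊗_
_⊗_ : ∀ {m n p} → Matrix ℚ m n → Matrix ℚ n p → Matrix ℚ m p
(A ⊗ B) i j = ℚ-Sum.sum (λ k → A i k * B k j)

infix 8 _ᵀ
_ᵀ : ∀ {m n} → Matrix ℚ m n → Matrix ℚ n m
(A ᵀ) i j = A j i

-- The four Penrose conditions. The matrices are rational, so the
-- conjugate transpose is the transpose.
record IsMoorePenroseInverse {m n} (A : Matrix ℚ m n) (A† : Matrix ℚ n m) : Set where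
  field
    AA†A≐A     : A ⊗ A† ⊗ A ≐ A
    A†AA†≐A†   : A† ⊗ A ⊗ A† ≐ A†
    AA†-symm   : (A ⊗ A†) ᵀ ≐ A ⊗ A†
    A†A-symm   : (A† ⊗ A) ᵀ ≐ A† ⊗ A

-- Determinant by cofactor expansion along the first row.
module Determinant (R : RawRing 0ℓ 0ℓ) where
  open RawRing R renaming (Carrier to C; _*_ to _·_; -_ to neg_)
  open RawSemiringDefinitions rawSemiring using (sum; _^_)

  det : ∀ {n} → Matrix C n n → C
  det {zero}  A = 1#
  det {suc n} A =
    sum (λ j → (neg 1#) ^ toℕ j · A zero j · det (λ r c → A (suc r) (punchIn j c)))

degree : ∀ {m} → Graph m → Fin m → ℕ
degree {m} G i = length (filter (adj? G i) (allFin m))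

degreeMatrix adjacencyMatrix laplacian : ∀ {m} → Graph m → Matrix ℚ m m
degreeMatrix    G i j = if does (i Fin.≟ j) then + degree G i / 1 else 0ℚ
adjacencyMatrix G i j = if does (adj? G i j) then 1ℚ else 0ℚ
laplacian       G i j = degreeMatrix G i j - adjacencyMatrix G i j

-- L† stands for the Moore–Penrose inverse of the Laplacian; it is an argument
-- because IsMoorePenroseInverse is a relation, not a function.
resistanceDistanceMatrix : ∀ {m} → Matrix ℚ m m → Matrix ℚ m m
resistanceDistanceMatrix L† i j = L† i i + L† j j - (+ 2 / 1) * L† i j

-- Polynomials over ℚ, as coefficient lists with the constant term first.
Poly : Set
Poly = List ℚ

coeff : Poly → ℕ → ℚ
coeff []      k       = 0ℚ
coeff (a ∷ p) zero    = a
coeff (a ∷ p) (suc k) = coeff p k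

-- Lists that differ only in trailing zeros are the same polynomial.
infix 4 _≈ₚ_
_≈ₚ_ : Rel Poly 0ℓ
p ≈ₚ q = ∀ k → coeff p k ≡ coeff q k

infixl 6 _+ₚ_
_+ₚ_ : Poly → Poly → Poly
[]      +ₚ q       = q
(a ∷ p) +ₚ []      = a ∷ p
(a ∷ p) +ₚ (b ∷ q) = a + b ∷ p +ₚ q

-- (a + X p) q = a q + X (p q)
infixl 7 _*ₚ_
_*ₚ_ : Poly → Poly → Poly
[]      *ₚ q = []
(a ∷ p) *ₚ q = map (a *_) q +ₚ (0ℚ ∷ p *ₚ q)

constₚ : ℚ → Poly
constₚ a = a ∷ []

X : Poly
X = 0ℚ ∷ 1ℚ ∷ []

polyRawRing : RawRing 0ℓ 0ℓ
polyRawRing = record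
  { Carrier = Poly
  ; _≈_     = _≈ₚ_
  ; _+_     = _+ₚ_
  ; _*_     = _*ₚ_
  ; -_      = map (-_)
  ; 0#      = []
  ; 1#      = constₚ 1ℚ
  }

charPoly : ∀ {n} → Matrix ℚ n n → Poly
charPoly A = Determinant.det polyRawRing
  (λ i j → (if does (i Fin.≟ j) then X else []) +ₚ constₚ (- A i j))

-- The list consists of all the eigenvalues, each repeated according to its
-- multiplicity as a root of the characteristic polynomial. Since the linear
-- factors exhaust that polynomial, there are no further eigenvalues in any
-- field extension of ℚ.
HasEigenvalues : ∀ {n} → Matrix ℚ n n → List ℚ → Set
HasEigenvalues A λs =
  charPoly A ≈ₚ foldr (λ μ p → (X +ₚ constₚ (- μ)) *ₚ p) (constₚ 1ℚ) λs

{-# OPTIONS --safe #-}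
module Submission where

-- Number the vertices of the product by pairs (v , u), with v a vertex of the
-- complete graph on n vertices and u one of the two vertices of the second
-- factor. Every matrix that occurs has entries
--   a [v = v′][u = u′] + b [v = v′] + c [u = u′] + d,
-- so it lies in the span of I, I ⊗ J₂, Jₙ ⊗ I and J, where J, J₂ and Jₙ have all
-- entries 1 and ⊗ is the Kronecker product. This span is closed under products
-- (entry-product). The Laplacian has the parameters (n + 2, -1, -1, 0).
-- With ν = 1/n and μ = 1/(n + 2), the matrix with parameters
--   μ, νμ, μ/2 and the d that makes all row sums vanish
-- times the Laplacian is I - J/(2n), on either side, and the Penrose conditions
-- follow. As a Moore–Penrose inverse is unique (moorePenrose-unique), this
-- matrix is the only one. The resistance distance matrix again lies in the span.
--
-- It remains to compute det (X I - R) for such an R, with the determinant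
-- defined by expansion along the first row. Over any commutative ring this
-- determinant is linear and alternating in the columns. Hence an eigenvector w
-- of A with eigenvalue s and w₀ = 1 splits off (det-deflate): det A is s times
-- the determinant of the map which A induces on the quotient by w, in the basis
-- of the remaining unit vectors. For a matrix in the span, the all-ones vector
-- gives the factor a + 2b + nc + 2nd, and then the indicator of u = 1 gives
-- a + nc. What A induces on the quotient by both is block diagonal, with n - 1
-- blocks a I + b J₂, and the same method splits off (a + 2b) a for each block
-- (det-blocks). If a, b, c and d are the parameters of -R, then over the ring of
-- polynomials X I - R has X + a, b, c and d, and its determinant is the product of
-- linear factors which HasEigenvalues asks for.

open import Algebra.Bundles using (CommutativeRing; Semiring)
open import Data.Bool using (true; false; if_then_else_; _∧_)
open import Data.Fin using (Fin; zero; suc; toℕ; fromℕ<; inject₁; punchIn; punchOut; remQuot)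
open import Data.Fin.Patterns using (0F; 1F)
import Data.Fin.Properties as Fin
import Data.Integer as ℤ
import Data.Integer.Properties as ℤ
import Data.Integer.Solver as ℤ
open import Data.List using (List; []; _∷_; _++_; foldr; replicate; map; length; filter; tabulate)
open import Data.Nat using (ℕ; zero; suc; NonZero)
import Data.Nat as ℕ
import Data.Nat.Properties as ℕ
open import Data.Nat.Properties using (m*n≢0)
open import Data.Product using (_×_; _,_; ∃; proj₁; proj₂; map₁)
open import Data.Rational using (ℚ; 0ℚ; 1ℚ; ½; _/_; fromℚᵘ)
import Data.Rational as ℚ
import Data.Rational.Properties as ℚ
import Data.Rational.Solver as ℚ
open import Data.Rational.Unnormalised using (mkℚᵘ; *≡*)
import Data.Rational.Unnormalised as ℚᵘ
import Data.Rational.Unnormalised.Properties as ℚᵘ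
open import Data.Vec.Functional using (Vector; updateAt)
open import Data.Vec.Functional.Properties using (updateAt-updates; updateAt-minimal)
open import Function using (_∘_; const; id)
open import Level using (0ℓ)
open import Relation.Binary.PropositionalEquality as ≡ using (_≡_; _≢_)
open import Relation.Nullary using (does; yes; no; contradiction)
open import Relation.Unary using (Pred; Decidable)
open import Defs

-- Determinants over a commutative ring

inject₁≢suc : ∀ {n} (j : Fin n) → inject₁ j ≢ suc j
inject₁≢suc (suc j) eq = inject₁≢suc j (Fin.suc-injective eq)

-- Deleting another column keeps two neighbouring columns neighbours.
punchIn-neighbours : ∀ {n} (k : Fin (2 ℕ.+ n)) (j : Fin (suc n)) →
  k ≢ inject₁ j → k ≢ suc j →
  ∃ λ j′ → punchIn k (inject₁ j′) ≡ inject₁ j × punchIn k (suc j′) ≡ suc j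
punchIn-neighbours zero zero p q = contradiction ≡.refl p
punchIn-neighbours {suc n} zero (suc j) p q = j , ≡.refl , ≡.refl
punchIn-neighbours (suc zero) zero p q = contradiction ≡.refl q
punchIn-neighbours (suc (suc zero)) zero p q = zero , ≡.refl , ≡.refl
punchIn-neighbours (suc (suc (suc k))) zero p q = zero , ≡.refl , ≡.refl
punchIn-neighbours {suc n} (suc k) (suc j) p q =
  let j′ , e , f = punchIn-neighbours k j (p ∘ ≡.cong suc) (q ∘ ≡.cong suc)
  in suc j′ , ≡.cong suc e , ≡.cong suc f

module Determinants (R : CommutativeRing 0ℓ 0ℓ) where
  open CommutativeRing R hiding (zero) renaming (Carrier to C)
  open import Algebra.Properties.Ring ring using (-1*x≈-x)
  open import Algebra.Properties.Semiring.Sum semiring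
  open import Algebra.Definitions.RawSemiring (Semiring.rawSemiring semiring) using (_^_)
  open import Algebra.Solver.Ring.NaturalCoefficients.Default commutativeSemiring
    using (solve; _:=_; _:+_; _:*_)
  open import Relation.Binary.Reasoning.Setoid setoid
  open Determinant rawRing using (det)

  -- The signs and minors of the expansion along the first row.
  sign : ∀ {n} → Fin n → C
  sign j = (- 1#) ^ toℕ j

  minor : ∀ {n} → Matrix C (suc n) (suc n) → Fin (suc n) → Matrix C n n
  minor A j r c = A (suc r) (punchIn j c)

  sum-zero : ∀ {n} {f : Vector C n} → (∀ k → f k ≈ 0#) → sum f ≈ 0#
  sum-zero {n} f≈0 = trans (sum-cong-≋ f≈0) (sum-replicate-zero n)

  sum-neighbours : ∀ {n} {f : Vector C (suc n)} (j : Fin n) →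
    (∀ k → k ≢ inject₁ j → k ≢ suc j → f k ≈ 0#) →
    f (inject₁ j) + f (suc j) ≈ 0# → sum f ≈ 0#
  sum-neighbours {suc n} {f} zero others pair = begin
    f zero + (f (suc zero) + sum (λ k → f (suc (suc k))))
      ≈⟨ +-assoc _ _ _ ⟨
    f zero + f (suc zero) + sum (λ k → f (suc (suc k)))
      ≈⟨ +-cong pair (sum-zero (λ k → others (suc (suc k)) (λ ()) (λ ()))) ⟩
    0# + 0#
      ≈⟨ +-identityˡ 0# ⟩
    0# ∎
  sum-neighbours {suc n} {f} (suc j) others pair =
    trans (+-cong (others zero (λ ()) (λ ()))
                  (sum-neighbours j (λ k p q → others (suc k) (p ∘ Fin.suc-injective) (q ∘ Fin.suc-injective)) pair))
          (+-identityˡ 0#)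

  det-cong : ∀ {n} (A B : Matrix C n n) → (∀ i j → A i j ≈ B i j) → det A ≈ det B
  det-cong {zero}  A B A≈B = refl
  det-cong {suc n} A B A≈B = sum-cong-≋ λ k →
    *-cong (*-congˡ {x = sign k} (A≈B zero k))
           (det-cong (minor A k) (minor B k) λ r c → A≈B (suc r) (punchIn k c))

  -- Linearity in column j: D agrees with A and B off column j, and its column j
  -- is the combination of theirs.
  det-linear : ∀ {n} (j : Fin n) (a b : C) (A B D : Matrix C n n) →
    (∀ i → D i j ≈ a * A i j + b * B i j) →
    (∀ i k → k ≢ j → D i k ≈ A i k) →
    (∀ i k → k ≢ j → D i k ≈ B i k) →
    det D ≈ a * det A + b * det B
  det-linear {suc n} j a b A B D at-j D≈A D≈B = begin
    sum (term D)
      ≈⟨ sum-cong-≋ split ⟩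
    sum (λ k → a * term A k + b * term B k)
      ≈⟨ ∑-distrib-+ (λ k → a * term A k) (λ k → b * term B k) ⟩
    sum (λ k → a * term A k) + sum (λ k → b * term B k)
      ≈⟨ +-cong (*-distribˡ-sum a (term A)) (*-distribˡ-sum b (term B)) ⟨
    a * det A + b * det B ∎
    where
    term : Matrix C (suc n) (suc n) → Vector C (suc n)
    term M k = sign k * M zero k * det (minor M k)

    split : ∀ k → term D k ≈ a * term A k + b * term B k
    split k with k Fin.≟ j
    ... | yes ≡.refl = begin
      sign k * D zero k * det (minor D k)
        ≈⟨ *-congʳ (*-congˡ (at-j zero)) ⟩
      sign k * (a * A zero k + b * B zero k) * det (minor D k)
        ≈⟨ solve 6 (λ s a x b y m → s :* (a :* x :+ b :* y) :* m := a :* (s :* x :* m) :+ b :* (s :* y :* m))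
             refl (sign k) a (A zero k) b (B zero k) (det (minor D k)) ⟩
      a * (sign k * A zero k * det (minor D k)) + b * (sign k * B zero k * det (minor D k))
        ≈⟨ +-cong (*-congˡ (*-congˡ (minor-cong A D≈A))) (*-congˡ (*-congˡ (minor-cong B D≈B))) ⟩
      a * term A k + b * term B k ∎
      where
      minor-cong : ∀ M → (∀ i l → l ≢ k → D i l ≈ M i l) → det (minor D k) ≈ det (minor M k)
      minor-cong M D≈M = det-cong (minor D k) (minor M k) λ r c → D≈M (suc r) _ (Fin.punchInᵢ≢i k c)
    ... | no k≢j = begin
      sign k * D zero k * det (minor D k)
        ≈⟨ *-congˡ (det-linear j′ a b (minor A k) (minor B k) (minor D k) at-j′
             (λ r c c≢j′ → D≈A (suc r) _ (c≢j′ ∘ back c)) (λ r c c≢j′ → D≈B (suc r) _ (c≢j′ ∘ back c))) ⟩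
      sign k * D zero k * (a * det (minor A k) + b * det (minor B k))
        ≈⟨ solve 6 (λ s x a p b q → s :* x :* (a :* p :+ b :* q) := a :* (s :* x :* p) :+ b :* (s :* x :* q))
             refl (sign k) (D zero k) a (det (minor A k)) b (det (minor B k)) ⟩
      a * (sign k * D zero k * det (minor A k)) + b * (sign k * D zero k * det (minor B k))
        ≈⟨ +-cong (*-congˡ (*-congʳ (*-congˡ (D≈A zero k k≢j)))) (*-congˡ (*-congʳ (*-congˡ (D≈B zero k k≢j)))) ⟩
      a * term A k + b * term B k ∎
      where
      j′ = punchOut k≢j

      back : ∀ c → punchIn k c ≡ j → c ≡ j′
      back c eq = Fin.punchIn-injective k c j′ (≡.trans eq (≡.sym (Fin.punchIn-punchOut k≢j)))

      at-j′ : ∀ r → minor D k r j′ ≈ a * minor A k r j′ + b * minor B k r j′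
      at-j′ r rewrite Fin.punchIn-punchOut k≢j = at-j (suc r)

  -- If two neighbouring columns agree, deleting either leaves the same matrix.
  punchIn-equal : ∀ {n} (x : Vector C (suc n)) (j : Fin n) →
    x (inject₁ j) ≈ x (suc j) → ∀ c → x (punchIn (inject₁ j) c) ≈ x (punchIn (suc j) c)
  punchIn-equal x zero    eq zero    = sym eq
  punchIn-equal x zero    eq (suc c) = refl
  punchIn-equal x (suc j) eq zero    = refl
  punchIn-equal x (suc j) eq (suc c) = punchIn-equal (x ∘ suc) j eq c

  -- In the expansion, the terms of the two equal columns cancel and every other
  -- minor still has two equal neighbouring columns.
  det-neighbours : ∀ {n} (A : Matrix C (suc n) (suc n)) (j : Fin n) →
    (∀ i → A i (inject₁ j) ≈ A i (suc j)) → det A ≈ 0#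
  det-neighbours {suc n} A j equal = sum-neighbours j others pair
    where
    others : ∀ k → k ≢ inject₁ j → k ≢ suc j → sign k * A zero k * det (minor A k) ≈ 0#
    others k p q with j′ , e , f ← punchIn-neighbours k j p q =
      trans (*-congˡ (det-neighbours (minor A k) j′ λ r → begin
        A (suc r) (punchIn k (inject₁ j′)) ≡⟨ ≡.cong (A (suc r)) e ⟩
        A (suc r) (inject₁ j)              ≈⟨ equal (suc r) ⟩
        A (suc r) (suc j)                  ≡⟨ ≡.cong (A (suc r)) f ⟨
        A (suc r) (punchIn k (suc j′))     ∎)) (zeroʳ _)

    s = sign (inject₁ j)
    x = A zero (suc j)
    m = det (minor A (suc j))

    pair : sign (inject₁ j) * A zero (inject₁ j) * det (minor A (inject₁ j))
         + sign (suc j) * A zero (suc j) * det (minor A (suc j)) ≈ 0#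
    pair = begin
      s * A zero (inject₁ j) * det (minor A (inject₁ j)) + - 1# * (- 1#) ^ toℕ j * x * m
        ≈⟨ +-cong (*-cong (*-congˡ (equal zero))
                          (det-cong (minor A (inject₁ j)) (minor A (suc j)) λ r → punchIn-equal (A (suc r)) j (equal (suc r))))
                  (*-congʳ (*-congʳ (*-congˡ (reflexive (≡.cong ((- 1#) ^_) (≡.sym (Fin.toℕ-inject₁ j))))))) ⟩
      s * x * m + - 1# * s * x * m
        ≈⟨ +-congˡ (trans (*-congʳ (*-assoc _ _ _)) (*-assoc _ _ _)) ⟩
      s * x * m + - 1# * (s * x * m)
        ≈⟨ +-congˡ (-1*x≈-x _) ⟩
      s * x * m + - (s * x * m)
        ≈⟨ -‿inverseʳ _ ⟩
      0# ∎

  -- The matrix A with column j replaced by v. Opacity lets unification recover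
  -- j, v and A from an entry.
  opaque
    setColumn : ∀ {m n} → Fin n → Vector C m → Matrix C m n → Matrix C m n
    setColumn j v A i = updateAt (A i) j (const (v i))

    set-at : ∀ {m n} (j : Fin n) {v : Vector C m} {A : Matrix C m n} → ∀ i → setColumn j v A i j ≈ v i
    set-at j {A = A} i = reflexive (updateAt-updates j (A i))

    set-off : ∀ {m n} (j : Fin n) {v : Vector C m} {A : Matrix C m n} → ∀ i k → k ≢ j → setColumn j v A i k ≈ A i k
    set-off j {A = A} i k k≢j = reflexive (updateAt-minimal k j (A i) k≢j)

  det-setColumn : ∀ {n} (j : Fin n) (v : Vector C n) (A B : Matrix C n n) →
    (∀ i → v i ≈ B i j) → (∀ i k → k ≢ j → A i k ≈ B i k) →
    det (setColumn j v A) ≈ det B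
  det-setColumn j v A B at off = det-cong (setColumn j v A) B λ i k → entry i k
    where
    entry : ∀ i k → setColumn j v A i k ≈ B i k
    entry i k with k Fin.≟ j
    ... | yes ≡.refl = trans (set-at j i) (at i)
    ... | no k≢j     = trans (set-off j i k k≢j) (off i k k≢j)

  det-column-combination : ∀ {n} (j : Fin n) (a b : C) (u v : Vector C n) (A : Matrix C n n) →
    det (setColumn j (λ i → a * u i + b * v i) A) ≈ a * det (setColumn j u A) + b * det (setColumn j v A)
  det-column-combination j a b u v A =
    det-linear j a b (setColumn j u A) (setColumn j v A) (setColumn j (λ i → a * u i + b * v i) A)
      (λ i → trans (set-at j i) (sym (+-cong (*-congˡ (set-at j i)) (*-congˡ (set-at j i)))))
      (λ i k p → trans (set-off j i k p) (sym (set-off j i k p)))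
      (λ i k p → trans (set-off j i k p) (sym (set-off j i k p)))

  det-setColumn-cong : ∀ {n} (j : Fin n) {u v : Vector C n} (A : Matrix C n n) →
    (∀ i → u i ≈ v i) → det (setColumn j u A) ≈ det (setColumn j v A)
  det-setColumn-cong j {u} {v} A u≈v = det-setColumn j u A (setColumn j v A)
    (λ i → trans (u≈v i) (sym (set-at j i))) (λ i k p → sym (set-off j i k p))

  det-column-scale : ∀ {n} (j : Fin n) (a : C) (u : Vector C n) (A : Matrix C n n) →
    det (setColumn j (λ i → a * u i) A) ≈ a * det (setColumn j u A)
  det-column-scale j a u A = begin
    det (setColumn j (λ i → a * u i) A)
      ≈⟨ det-setColumn-cong j A (λ i → x+0y (a * u i) (u i)) ⟨
    det (setColumn j (λ i → a * u i + 0# * u i) A)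
      ≈⟨ det-column-combination j a 0# u u A ⟩
    a * det (setColumn j u A) + 0# * det (setColumn j u A)
      ≈⟨ x+0y _ _ ⟩
    a * det (setColumn j u A) ∎
    where
    x+0y : ∀ x y → x + 0# * y ≈ x
    x+0y x y = trans (+-congˡ (zeroˡ y)) (+-identityʳ x)

  det-column-sum : ∀ {m n} (j : Fin n) (c : Vector C m) (V : Fin m → Vector C n) (A : Matrix C n n) →
    det (setColumn j (λ i → sum (λ k → c k * V k i)) A) ≈ sum (λ k → c k * det (setColumn j (V k) A))
  det-column-sum {zero} j c V A = begin
    det (setColumn j (λ _ → 0#) A)
      ≈⟨ det-setColumn-cong j A (λ _ → zeroˡ 0#) ⟨
    det (setColumn j (λ _ → 0# * 0#) A)
      ≈⟨ det-column-scale j 0# (λ _ → 0#) A ⟩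
    0# * det (setColumn j (λ _ → 0#) A)
      ≈⟨ zeroˡ _ ⟩
    0# ∎
  det-column-sum {suc m} {n} j c V A = begin
    det (setColumn j (λ i → c zero * V zero i + rest i) A)
      ≈⟨ det-setColumn-cong j A (λ i → +-congˡ (*-identityˡ (rest i))) ⟨
    det (setColumn j (λ i → c zero * V zero i + 1# * rest i) A)
      ≈⟨ det-column-combination j (c zero) 1# (V zero) rest A ⟩
    c zero * det (setColumn j (V zero) A) + 1# * det (setColumn j rest A)
      ≈⟨ +-congˡ (trans (*-identityˡ _) (det-column-sum j (c ∘ suc) (V ∘ suc) A)) ⟩
    c zero * det (setColumn j (V zero) A) + sum (λ k → c (suc k) * det (setColumn j (V (suc k)) A)) ∎
    where
    rest : Vector C n
    rest i = sum (λ k → c (suc k) * V (suc k) i)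

  -- Adding a multiple of v to a column changes nothing, if v in place of
  -- that column gives determinant zero.
  det-add : ∀ {n} (j : Fin n) (c : C) (v : Vector C n) (A : Matrix C n n) →
    det (setColumn j v A) ≈ 0# →
    det (setColumn j (λ i → A i j + c * v i) A) ≈ det A
  det-add {n} j c v A zero! = begin
    det (setColumn j (λ i → A i j + c * v i) A)
      ≈⟨ det-setColumn-cong j A (λ i → +-congʳ (*-identityˡ (A i j))) ⟨
    det (setColumn j (λ i → 1# * A i j + c * v i) A)
      ≈⟨ det-column-combination j 1# c (λ i → A i j) v A ⟩
    1# * det (setColumn j (λ i → A i j) A) + c * det (setColumn j v A)
      ≈⟨ +-cong (*-identityˡ _) (trans (*-congˡ zero!) (zeroʳ c)) ⟩
    det (setColumn j (λ i → A i j) A) + 0#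
      ≈⟨ +-identityʳ _ ⟩
    det (setColumn j (λ i → A i j) A)
      ≈⟨ det-setColumn j (λ i → A i j) A A (λ _ → refl) (λ _ _ _ → refl) ⟩
    det A ∎

  -- Equal columns i and j give determinant zero, by induction on their distance.
  -- With y the column k just before j and x the common value of columns i and j,
  -- add y to column j and then x to column k. Neither changes the determinant,
  -- by the cases of neighbours and of a smaller distance, and now columns k and j are both x + y.
  det-gap : ∀ d {n} (A : Matrix C n n) (i j : Fin n) → toℕ j ≡ suc d ℕ.+ toℕ i →
    (∀ r → A r i ≈ A r j) → det A ≈ 0#
  det-gap zero A i (suc j) gap equal =
    det-neighbours A j λ r → trans (reflexive (≡.cong (A r) (≡.sym i≡j))) (equal r)
    where
    i≡j : i ≡ inject₁ j
    i≡j = Fin.toℕ-injective (≡.sym (≡.trans (Fin.toℕ-inject₁ j) (ℕ.suc-injective gap)))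
  det-gap (suc d) {suc n} A i (suc j) gap equal = begin
    det A  ≈⟨ det-add (suc j) 1# (λ r → A r k) A (det-neighbours (setColumn (suc j) (λ r → A r k) A) j λ r →
                trans (set-off (suc j) r k k≢sj) (sym (set-at (suc j) r))) ⟨
    det A₁ ≈⟨ det-add k 1# (λ r → A₁ r i) A₁ (det-gap d (setColumn k (λ r → A₁ r i) A₁) i k gap′ λ r →
                trans (set-off k r i i≢k) (sym (set-at k r))) ⟨
    det A₂ ≈⟨ det-neighbours A₂ j A₂-equal ⟩
    0# ∎
    where
    k = inject₁ j
    A₁ = setColumn (suc j) (λ r → A r (suc j) + 1# * A r k) A
    A₂ = setColumn k (λ r → A₁ r k + 1# * A₁ r i) A₁

    gap′ : toℕ k ≡ suc d ℕ.+ toℕ i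
    gap′ = ≡.trans (Fin.toℕ-inject₁ j) (ℕ.suc-injective gap)

    k≢sj : k ≢ suc j
    k≢sj = inject₁≢suc j

    i≢k : i ≢ k
    i≢k eq = ℕ.m≢1+n+m (toℕ i) (≡.trans (≡.cong toℕ eq) gap′)

    i≢sj : i ≢ suc j
    i≢sj eq = ℕ.m≢1+n+m (toℕ i) (≡.trans (≡.cong toℕ eq) gap)

    A₂-equal : ∀ r → A₂ r k ≈ A₂ r (suc j)
    A₂-equal r = begin
      A₂ r k                     ≈⟨ set-at k r ⟩
      A₁ r k + 1# * A₁ r i       ≈⟨ +-cong (set-off (suc j) r k k≢sj) (trans (*-identityˡ _) (trans (set-off (suc j) r i i≢sj) (equal r))) ⟩
      A r k + A r (suc j)        ≈⟨ +-comm _ _ ⟩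
      A r (suc j) + A r k        ≈⟨ +-congˡ (*-identityˡ _) ⟨
      A r (suc j) + 1# * A r k   ≈⟨ set-at (suc j) r ⟨
      A₁ r (suc j)               ≈⟨ set-off k r (suc j) (k≢sj ∘ ≡.sym) ⟨
      A₂ r (suc j)               ∎

  det-first-column : ∀ {n} (A : Matrix C (suc n) (suc n)) (j : Fin n) →
    (∀ r → A r zero ≈ A r (suc j)) → det A ≈ 0#
  det-first-column A j = det-gap (toℕ j) A zero (suc j) (≡.cong suc (≡.sym (ℕ.+-identityʳ (toℕ j))))

  -- Adding multiples of the first column to all the others at once.
  det-clear : ∀ {n} (c : Vector C n) (A B : Matrix C (suc n) (suc n)) →
    (∀ i → B i zero ≈ A i zero) →
    (∀ i j → B i (suc j) ≈ A i (suc j) + c j * A i zero) →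
    det B ≈ det A
  det-clear {n} c₀ A = go n c₀ (λ j n≤j → contradiction n≤j (ℕ.<⇒≱ (Fin.toℕ<n j)))
    where
    -- The case in which at most the first k of the other columns change.
    go : ∀ k (c : Vector C n) → (∀ j → k ℕ.≤ toℕ j → c j ≈ 0#) → ∀ (B : Matrix C (suc n) (suc n)) →
      (∀ i → B i zero ≈ A i zero) →
      (∀ i j → B i (suc j) ≈ A i (suc j) + c j * A i zero) →
      det B ≈ det A
    go zero c c≈0 B first other = det-cong B A λ
      { i zero    → first i
      ; i (suc j) → trans (other i j) (trans (+-congˡ (trans (*-congʳ (c≈0 j ℕ.z≤n)) (zeroˡ _))) (+-identityʳ _)) }
    go (suc k) c c≈0 B first other with k ℕ.<? n
    ... | no k≮n = go k c (λ j k≤j → contradiction (ℕ.≤-<-trans k≤j (Fin.toℕ<n j)) k≮n) B first other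
    ... | yes k<n = begin
      det B
        ≈⟨ det-setColumn (suc l) (λ i → D i (suc l) + c l * D i zero) D B
             (λ i → trans (+-cong (set-at (suc l) i) (*-congˡ (D-first i))) (sym (other i l)))
             (λ i j p → set-off (suc l) i j p) ⟨
      det (setColumn (suc l) (λ i → D i (suc l) + c l * D i zero) D)
        ≈⟨ det-add (suc l) (c l) (λ i → D i zero) D
             (det-first-column (setColumn (suc l) (λ i → D i zero) D) l λ r →
               trans (set-off (suc l) r zero (λ ())) (sym (set-at (suc l) r))) ⟩
      det D
        ≈⟨ go k c′ c′≈0 D D-first D-other ⟩
      det A ∎
      where
      l : Fin n
      l = fromℕ< k<n

      c′ : Vector C n
      c′ = updateAt c l (const 0#)

      D = setColumn (suc l) (λ i → A i (suc l)) B

      D-first : ∀ i → D i zero ≈ A i zero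
      D-first i = trans (set-off (suc l) i zero (λ ())) (first i)

      c′≈0 : ∀ j → k ℕ.≤ toℕ j → c′ j ≈ 0#
      c′≈0 j k≤j with j Fin.≟ l
      ... | yes ≡.refl = reflexive (updateAt-updates l c)
      ... | no j≢l = trans (reflexive (updateAt-minimal j l c j≢l))
              (c≈0 j (ℕ.≤∧≢⇒< k≤j λ k≡j → j≢l (Fin.toℕ-injective (≡.trans (≡.sym k≡j) (≡.sym (Fin.toℕ-fromℕ< k<n))))))

      D-other : ∀ i j → D i (suc j) ≈ A i (suc j) + c′ j * A i zero
      D-other i j with j Fin.≟ l
      ... | yes ≡.refl = trans (set-at (suc l) i) (sym (trans (+-congˡ (trans (*-congʳ (reflexive (updateAt-updates l c))) (zeroˡ _))) (+-identityʳ _)))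
      ... | no j≢l = trans (set-off (suc l) i (suc j) (j≢l ∘ Fin.suc-injective))
              (trans (other i j) (+-congˡ (*-congʳ (sym (reflexive (updateAt-minimal j l c j≢l))))))

  -- An eigenvector w of A with first entry 1 splits off its eigenvalue s. The
  -- matrix B is that of the map which A induces on the quotient by w, in the
  -- basis of the unit vectors other than the first.
  -- Putting A w in place of the first column of A leaves the determinant
  -- unchanged, and A w = s w. Once s is taken out, multiples of w clear the rest
  -- of the first row.
  det-deflate : ∀ {n} (A : Matrix C (suc n) (suc n)) (B : Matrix C n n) (s : C) (w : Vector C (suc n)) →
    w zero ≈ 1# →
    (∀ i → sum (λ k → A i k * w k) ≈ s * w i) →
    (∀ i j → A (suc i) (suc j) ≈ B i j + w (suc i) * A zero (suc j)) →
    det A ≈ s * det B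
  det-deflate {n} A B s w w₀≈1 eigen quotient = begin
    det A
      ≈⟨ det-setColumn zero (col zero) A A (λ _ → refl) (λ _ _ _ → refl) ⟨
    det (setColumn zero (col zero) A)
      ≈⟨ trans (+-identityʳ _) (trans (*-congʳ w₀≈1) (*-identityˡ _)) ⟨
    w zero * det (setColumn zero (col zero) A) + 0#
      ≈⟨ +-congˡ (sum-zero λ k → trans (*-congˡ (det-first-column (setColumn zero (col (suc k)) A) k λ r →
           trans (set-at zero r) (sym (set-off zero r (suc k) (λ ()))))) (zeroʳ (w (suc k)))) ⟨
    sum (λ k → w k * det (setColumn zero (col k) A))
      ≈⟨ det-column-sum zero w col A ⟨
    det (setColumn zero (λ i → sum (λ k → w k * A i k)) A)
      ≈⟨ det-setColumn-cong zero A (λ i → trans (sum-cong-≋ λ k → *-comm (w k) (A i k)) (eigen i)) ⟩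
    det (setColumn zero (λ i → s * w i) A)
      ≈⟨ det-column-scale zero s w A ⟩
    s * det (setColumn zero w A)
      ≈⟨ *-congˡ (det-clear (λ j → A zero (suc j)) A′ (setColumn zero w A) (set-at zero) cleared) ⟩
    s * det A′
      ≈⟨ *-congˡ first-row ⟩
    s * det B ∎
    where
    col : Fin (suc n) → Vector C (suc n)
    col k i = A i k

    A′ : Matrix C (suc n) (suc n)
    A′ i       zero    = w i
    A′ zero    (suc j) = 0#
    A′ (suc i) (suc j) = B i j

    cleared : ∀ i j → setColumn zero w A i (suc j) ≈ A′ i (suc j) + A zero (suc j) * w i
    cleared zero    j = trans (set-off zero zero (suc j) (λ ()))
      (sym (trans (+-identityˡ _) (trans (*-congˡ w₀≈1) (*-identityʳ _))))
    cleared (suc i) j = trans (set-off zero (suc i) (suc j) (λ ()))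
      (trans (quotient i j) (+-congˡ (*-comm _ _)))

    first-row : det A′ ≈ det B
    first-row = begin
      1# * w zero * det B + sum (λ k → sign (suc k) * 0# * det (minor A′ (suc k)))
        ≈⟨ +-cong (*-congʳ (trans (*-identityˡ _) w₀≈1))
                  (sum-zero λ k → trans (*-congʳ {x = det (minor A′ (suc k))} (zeroʳ (sign (suc k)))) (zeroˡ (det (minor A′ (suc k))))) ⟩
      1# * det B + 0#
        ≈⟨ trans (+-identityʳ _) (*-identityˡ _) ⟩
      det B ∎

-- Matrices indexed by pairs

module PairMatrices (R : CommutativeRing 0ℓ 0ℓ) where
  open CommutativeRing R hiding (zero) renaming (Carrier to C)
  open Determinants R
  open import Algebra.Properties.Ring ring using (+-cancelʳ)
  open import Algebra.Properties.Semiring.Sum semiring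
  open import Algebra.Properties.Semiring.Mult semiring using (×-assoc-*; ×-congʳ) renaming (_×_ to _⊠_)
  open import Algebra.Definitions.RawSemiring (Semiring.rawSemiring semiring) using (_^_)
  open import Algebra.Solver.Ring.NaturalCoefficients.Default commutativeSemiring
    using (solve; _:=_; _:+_; _:*_)
  open import Relation.Binary.Reasoning.Setoid setoid
  open Determinant rawRing using (det)

  -- Two deflations: y is an eigenvector modulo w, and y itself has first entry 0
  -- and second entry 1. The vector q is the first row that A induces on the
  -- quotient by w, without its first entry.
  det-deflate₂ : ∀ {n} (A : Matrix C (2 ℕ.+ n) (2 ℕ.+ n)) (B : Matrix C n n) (s t r : C)
    (w y : Vector C (2 ℕ.+ n)) (q : Vector C n) →
    w 0F ≈ 1# → y 0F ≈ 0# → y 1F ≈ 1# →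
    (∀ i → sum (λ k → A i k * w k) ≈ s * w i) →
    (∀ i → sum (λ k → A i k * y k) ≈ t * y i + r * w i) →
    (∀ j → A 1F (suc (suc j)) ≈ q j + w 1F * A 0F (suc (suc j))) →
    (∀ i j → A (suc (suc i)) (suc (suc j)) ≈ B i j + y (suc (suc i)) * q j + w (suc (suc i)) * A 0F (suc (suc j))) →
    det A ≈ s * (t * det B)
  det-deflate₂ {n} A B s t r w y q w₀ y₀ y₁ Aw Ay row₁ rows =
    trans (det-deflate A A′ s w w₀ Aw (λ i j → sym (A′+ i j)))
          (*-congˡ (det-deflate A′ B t (y ∘ suc) y₁ A′y rows′))
    where
    A′ : Matrix C (suc n) (suc n)
    A′ i j = A (suc i) (suc j) - w (suc i) * A 0F (suc j)

    A′+ : ∀ i j → A′ i j + w (suc i) * A 0F (suc j) ≈ A (suc i) (suc j)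
    A′+ i j = trans (+-assoc _ _ _) (trans (+-congˡ (-‿inverseˡ _)) (+-identityʳ _))

    -- As y₀ = 0, this is the product of row i with y.
    row : Fin (2 ℕ.+ n) → C
    row i = sum (λ k → A i (suc k) * y (suc k))

    row≈ : ∀ i → row i ≈ t * y i + r * w i
    row≈ i = trans (sym (trans (+-congʳ (trans (*-congˡ y₀) (zeroʳ _))) (+-identityˡ _))) (Ay i)

    row₀ : row 0F ≈ r
    row₀ = begin
      row 0F              ≈⟨ row≈ 0F ⟩
      t * y 0F + r * w 0F ≈⟨ +-cong (trans (*-congˡ y₀) (zeroʳ t)) (trans (*-congˡ w₀) (*-identityʳ r)) ⟩
      0# + r              ≈⟨ +-identityˡ r ⟩
      r                   ∎

    A′y : ∀ i → sum (λ k → A′ i k * y (suc k)) ≈ t * y (suc i)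
    A′y i = +-cancelʳ (r * w (suc i)) _ _ (begin
      sum (λ k → A′ i k * y (suc k)) + r * w (suc i)
        ≈⟨ +-congˡ (trans (*-congʳ (sym row₀)) (trans (*-comm _ _) (*-distribˡ-sum (w (suc i)) (λ k → A 0F (suc k) * y (suc k))))) ⟩
      sum (λ k → A′ i k * y (suc k)) + sum (λ k → w (suc i) * (A 0F (suc k) * y (suc k)))
        ≈⟨ ∑-distrib-+ (λ k → A′ i k * y (suc k)) (λ k → w (suc i) * (A 0F (suc k) * y (suc k))) ⟨
      sum (λ k → A′ i k * y (suc k) + w (suc i) * (A 0F (suc k) * y (suc k)))
        ≈⟨ sum-cong-≋ (λ k → trans (+-congˡ (sym (*-assoc _ _ _))) (trans (sym (distribʳ (y (suc k)) _ _)) (*-congʳ (A′+ i k)))) ⟩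
      row (suc i)
        ≈⟨ row≈ (suc i) ⟩
      t * y (suc i) + r * w (suc i) ∎)

    A′₀ : ∀ j → A′ 0F (suc j) ≈ q j
    A′₀ j = +-cancelʳ (w 1F * A 0F (suc (suc j))) _ _ (trans (A′+ 0F (suc j)) (row₁ j))

    rows′ : ∀ i j → A′ (suc i) (suc j) ≈ B i j + y (suc (suc i)) * A′ 0F (suc j)
    rows′ i j = +-cancelʳ (w (suc (suc i)) * A 0F (suc (suc j))) _ _
      (trans (A′+ (suc i) (suc j)) (trans (rows i j) (+-congʳ (+-congˡ (*-congˡ (sym (A′₀ j)))))))

  -- Kronecker delta.
  δ : ∀ {n} → Fin n → Fin n → C
  δ i j = if does (i Fin.≟ j) then 1# else 0#

  sum-δˡ : ∀ {n} (v : Fin n) (f : Vector C n) → sum (λ w → δ v w * f w) ≈ f v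
  sum-δˡ zero    f = trans (+-cong (*-identityˡ _) (sum-zero λ w → zeroˡ (f (suc w)))) (+-identityʳ _)
  sum-δˡ (suc v) f = trans (+-cong (zeroˡ _) (sum-δˡ v (f ∘ suc))) (+-identityˡ _)

  sum-δ : ∀ {n} (v : Fin n) → sum (λ w → δ w v) ≈ 1#
  sum-δ {suc n} zero = trans (+-congˡ (sum-zero {n} λ w → refl)) (+-identityʳ _)
  sum-δ (suc v) = trans (+-identityˡ _) (sum-δ v)

  -- The ring element n is written n ⊠ 1#, the sum of n ones.
  sum-const : ∀ n x → sum {n} (λ _ → x) ≈ (n ⊠ 1#) * x
  sum-const n x = trans (sum-replicate n) (sym (trans (×-assoc-* n 1# x) (×-congʳ n (*-identityˡ x))))

  pick : ∀ (u : Fin 2) (f : Fin 2 → C) → δ u 0F * f 0F + δ u 1F * f 1F ≈ f u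
  pick 0F f = trans (+-cong (*-identityˡ _) (zeroˡ _)) (+-identityʳ _)
  pick 1F f = trans (+-cong (zeroˡ _) (*-identityˡ _)) (+-identityˡ _)

  sum-pairs : ∀ n (h : Fin n × Fin 2 → C) →
    sum (λ k → h (remQuot {n} 2 k)) ≈ sum (λ v → h (v , 0F) + h (v , 1F))
  sum-pairs zero    h = refl
  sum-pairs (suc n) h = trans (sym (+-assoc _ _ _)) (+-congˡ (sum-pairs n (h ∘ map₁ suc)))

  -- The entries of a I + b (I ⊗ J₂) + c (Jₙ ⊗ I) + d J, in Kronecker notation,
  -- at pairs of indices.
  entry : ∀ {n} → (a b c d : C) → Fin n × Fin 2 → Fin n × Fin 2 → C
  entry a b c d (v , u) (v′ , u′) = a * (δ v v′ * δ u u′) + b * δ v v′ + c * δ u u′ + d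

  pairMatrix : ∀ n → (a b c d : C) → Matrix C (n ℕ.* 2) (n ℕ.* 2)
  pairMatrix n a b c d i j = entry a b c d (remQuot {n} 2 i) (remQuot {n} 2 j)

  -- The matrix with parameters a b c d applied to the vector g, at index (v , u).
  action : ∀ {n} a b c d (v : Fin n) (u : Fin 2) (g : Fin n × Fin 2 → C) →
    sum (λ k → entry a b c d (v , u) (remQuot {n} 2 k) * g (remQuot {n} 2 k))
    ≈ a * g (v , u) + b * (g (v , 0F) + g (v , 1F))
    + (c * sum (λ w → g (w , u)) + d * sum (λ w → g (w , 0F) + g (w , 1F)))
  action {n} a b c d v u g = begin
    sum (λ k → entry a b c d (v , u) (remQuot {n} 2 k) * g (remQuot {n} 2 k))
      ≈⟨ sum-pairs n (λ p → entry a b c d (v , u) p * g p) ⟩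
    sum (λ w → entry a b c d (v , u) (w , 0F) * g (w , 0F) + entry a b c d (v , u) (w , 1F) * g (w , 1F))
      ≈⟨ sum-cong-≋ at ⟩
    sum (λ w → δ v w * local w + (c * g (w , u) + d * total w))
      ≈⟨ ∑-distrib-+ (λ w → δ v w * local w) (λ w → c * g (w , u) + d * total w) ⟩
    sum (λ w → δ v w * local w) + sum (λ w → c * g (w , u) + d * total w)
      ≈⟨ +-cong (sum-δˡ v local) (trans (∑-distrib-+ (λ w → c * g (w , u)) (λ w → d * total w))
           (sym (+-cong (*-distribˡ-sum c (λ w → g (w , u))) (*-distribˡ-sum d total)))) ⟩
    local v + (c * sum (λ w → g (w , u)) + d * sum total) ∎
    where
    total local : Fin n → C
    total w = g (w , 0F) + g (w , 1F)
    local w = a * g (w , u) + b * total w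

    at : ∀ w → entry a b c d (v , u) (w , 0F) * g (w , 0F) + entry a b c d (v , u) (w , 1F) * g (w , 1F)
             ≈ δ v w * local w + (c * g (w , u) + d * total w)
    at w = begin
      entry a b c d (v , u) (w , 0F) * g (w , 0F) + entry a b c d (v , u) (w , 1F) * g (w , 1F)
        ≈⟨ solve 9 (λ a b c d e x₀ x₁ g₀ g₁ →
             (a :* (e :* x₀) :+ b :* e :+ c :* x₀ :+ d) :* g₀ :+ (a :* (e :* x₁) :+ b :* e :+ c :* x₁ :+ d) :* g₁
             := e :* (a :* (x₀ :* g₀ :+ x₁ :* g₁) :+ b :* (g₀ :+ g₁)) :+ (c :* (x₀ :* g₀ :+ x₁ :* g₁) :+ d :* (g₀ :+ g₁)))
             refl a b c d (δ v w) (δ u 0F) (δ u 1F) (g (w , 0F)) (g (w , 1F)) ⟩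
      δ v w * (a * x + b * total w) + (c * x + d * total w)
        ≈⟨ +-cong (*-congˡ (+-congʳ (*-congˡ x≈))) (+-congʳ (*-congˡ x≈)) ⟩
      δ v w * local w + (c * g (w , u) + d * total w) ∎
      where
      x = δ u 0F * g (w , 0F) + δ u 1F * g (w , 1F)
      x≈ : x ≈ g (w , u)
      x≈ = pick u (λ t → g (w , t))

  -- The product of two such matrices is of the same form.
  entry-product : ∀ n a b c d a′ b′ c′ d′ p q → let N = n ⊠ 1# in
    sum (λ k → entry a b c d p (remQuot {n} 2 k) * entry a′ b′ c′ d′ (remQuot {n} 2 k) q)
    ≈ entry (a * a′) (a * b′ + b * a′ + (b * b′ + b * b′)) (a * c′ + c * a′ + N * (c * c′))
        (a * d′ + d * a′ + (b * c′ + c * b′) + (b * d′ + d * b′) + (b * d′ + d * b′)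
          + N * (c * d′ + d * c′) + N * (d * d′ + d * d′)) p q
  entry-product n a b c d a′ b′ c′ d′ (v , u) (v′ , u′) = begin
    sum (λ k → entry a b c d (v , u) (remQuot {n} 2 k) * g (remQuot {n} 2 k))
      ≈⟨ action a b c d v u g ⟩
    a * g (v , u) + b * (g (v , 0F) + g (v , 1F)) + (c * sum (λ w → g (w , u)) + d * sum (λ w → g (w , 0F) + g (w , 1F)))
      ≈⟨ +-cong (+-congˡ (*-congˡ (both v)))
           (+-cong (*-congˡ (column u))
                   (*-congˡ (trans (∑-distrib-+ (λ w → g (w , 0F)) (λ w → g (w , 1F))) (+-cong (column 0F) (column 1F))))) ⟩
    a * g (v , u) + b * (a′ * e * x + (b′ * e + b′ * e) + c′ * x + (d′ + d′))
      + (c * (a′ * δ u u′ + b′ + N * (c′ * δ u u′ + d′))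
      + d * ((a′ * x₀ + b′ + N * (c′ * x₀ + d′)) + (a′ * x₁ + b′ + N * (c′ * x₁ + d′))))
      ≈⟨ +-congˡ (+-congˡ (*-congˡ (solve 7 (λ a′ b′ c′ d′ N x₀ x₁ →
           (a′ :* x₀ :+ b′ :+ N :* (c′ :* x₀ :+ d′)) :+ (a′ :* x₁ :+ b′ :+ N :* (c′ :* x₁ :+ d′))
           := a′ :* (x₀ :+ x₁) :+ (b′ :+ b′) :+ N :* (c′ :* (x₀ :+ x₁) :+ (d′ :+ d′))) refl a′ b′ c′ d′ N x₀ x₁))) ⟩
    a * g (v , u) + b * (a′ * e * x + (b′ * e + b′ * e) + c′ * x + (d′ + d′))
      + (c * (a′ * δ u u′ + b′ + N * (c′ * δ u u′ + d′))
      + d * (a′ * x + (b′ + b′) + N * (c′ * x + (d′ + d′))))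
      ≈⟨ +-cong (+-congˡ (*-congˡ (+-congʳ (+-cong (+-congʳ (·x≈ _)) (·x≈ _)))))
           (+-congˡ (*-congˡ (+-cong (+-congʳ (·x≈ _)) (*-congˡ (+-congʳ (·x≈ _)))))) ⟩
    a * g (v , u) + b * (a′ * e + (b′ * e + b′ * e) + c′ + (d′ + d′))
      + (c * (a′ * δ u u′ + b′ + N * (c′ * δ u u′ + d′))
      + d * (a′ + (b′ + b′) + N * (c′ + (d′ + d′))))
      ≈⟨ solve 11 (λ a b c d a′ b′ c′ d′ N e f →
           a :* (a′ :* (e :* f) :+ b′ :* e :+ c′ :* f :+ d′) :+ b :* (a′ :* e :+ (b′ :* e :+ b′ :* e) :+ c′ :+ (d′ :+ d′))
           :+ (c :* (a′ :* f :+ b′ :+ N :* (c′ :* f :+ d′))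
           :+ d :* (a′ :+ (b′ :+ b′) :+ N :* (c′ :+ (d′ :+ d′))))
           := (a :* a′) :* (e :* f) :+ (a :* b′ :+ b :* a′ :+ (b :* b′ :+ b :* b′)) :* e :+ (a :* c′ :+ c :* a′ :+ N :* (c :* c′)) :* f
           :+ (a :* d′ :+ d :* a′ :+ (b :* c′ :+ c :* b′) :+ (b :* d′ :+ d :* b′) :+ (b :* d′ :+ d :* b′)
           :+ N :* (c :* d′ :+ d :* c′) :+ N :* (d :* d′ :+ d :* d′)))
           refl a b c d a′ b′ c′ d′ N e (δ u u′) ⟩
    _ ∎
    where
    N e x₀ x₁ x : C
    N = n ⊠ 1#
    e = δ v v′
    x₀ = δ 0F u′
    x₁ = δ 1F u′
    x = x₀ + x₁

    g : Fin n × Fin 2 → C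
    g p = entry a′ b′ c′ d′ p (v′ , u′)

    x≈1 : x ≈ 1#
    x≈1 = trans (+-congˡ (sym (+-identityʳ x₁))) (sum-δ u′)

    ·x≈ : ∀ z → z * x ≈ z
    ·x≈ z = trans (*-congˡ x≈1) (*-identityʳ z)

    both : ∀ w → g (w , 0F) + g (w , 1F) ≈ a′ * δ w v′ * x + (b′ * δ w v′ + b′ * δ w v′) + c′ * x + (d′ + d′)
    both w = solve 7 (λ a′ b′ c′ d′ e x₀ x₁ →
      (a′ :* (e :* x₀) :+ b′ :* e :+ c′ :* x₀ :+ d′) :+ (a′ :* (e :* x₁) :+ b′ :* e :+ c′ :* x₁ :+ d′)
      := a′ :* e :* (x₀ :+ x₁) :+ (b′ :* e :+ b′ :* e) :+ c′ :* (x₀ :+ x₁) :+ (d′ :+ d′))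
      refl a′ b′ c′ d′ (δ w v′) x₀ x₁

    column : ∀ t → sum (λ w → g (w , t)) ≈ a′ * δ t u′ + b′ + N * (c′ * δ t u′ + d′)
    column t = begin
      sum (λ w → g (w , t))
        ≈⟨ sum-cong-≋ (λ w → solve 6 (λ a′ b′ c′ d′ e f → a′ :* (e :* f) :+ b′ :* e :+ c′ :* f :+ d′
             := (a′ :* f :+ b′) :* e :+ (c′ :* f :+ d′)) refl a′ b′ c′ d′ (δ w v′) (δ t u′)) ⟩
      sum (λ w → (a′ * δ t u′ + b′) * δ w v′ + (c′ * δ t u′ + d′))
        ≈⟨ ∑-distrib-+ (λ w → (a′ * δ t u′ + b′) * δ w v′) (λ _ → c′ * δ t u′ + d′) ⟩
      sum (λ w → (a′ * δ t u′ + b′) * δ w v′) + sum {n} (λ _ → c′ * δ t u′ + d′)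
        ≈⟨ +-cong (sym (*-distribˡ-sum (a′ * δ t u′ + b′) (λ w → δ w v′))) (sum-const n _) ⟩
      (a′ * δ t u′ + b′) * sum (λ w → δ w v′) + N * (c′ * δ t u′ + d′)
        ≈⟨ +-congʳ (trans (*-congˡ (sum-δ v′)) (*-identityʳ _)) ⟩
      a′ * δ t u′ + b′ + N * (c′ * δ t u′ + d′) ∎

  -- The block diagonal matrix with m blocks a I + b J₂. The indicator w of the
  -- first block is an eigenvector for a + 2b, and the unit vector y at (0 , 1) is
  -- one for a modulo w; the quotient by both consists of the other blocks.
  det-blocks : ∀ m a b → det (pairMatrix m a b 0# 0#) ≈ ((a + (b + b)) * a) ^ m
  det-blocks zero    a b = refl
  det-blocks (suc m) a b = begin
    det (pairMatrix (suc m) a b 0# 0#)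
      ≈⟨ det-deflate₂ (pairMatrix (suc m) a b 0# 0#) (pairMatrix m a b 0# 0#) (a + (b + b)) a b
           (λ i → w (remQuot {suc m} 2 i)) (λ i → y (remQuot {suc m} 2 i)) (λ _ → 0#)
           refl (zeroʳ 1#) (*-identityʳ 1#) Aw Ay row₁ rows ⟩
    (a + (b + b)) * (a * det (pairMatrix m a b 0# 0#))
      ≈⟨ *-assoc _ _ _ ⟨
    (a + (b + b)) * a * det (pairMatrix m a b 0# 0#)
      ≈⟨ *-congˡ (det-blocks m a b) ⟩
    (a + (b + b)) * a * ((a + (b + b)) * a) ^ m ∎
    where
    w y : Fin (suc m) × Fin 2 → C
    w (v , u) = δ v 0F
    y (v , u) = δ v 0F * δ u 1F

    drop : ∀ x S T → x + (0# * S + 0# * T) ≈ x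
    drop x S T = trans (+-congˡ (trans (+-cong (zeroˡ S) (zeroˡ T)) (+-identityˡ 0#))) (+-identityʳ x)

    Aw : ∀ i → _
    Aw i = let v , u = remQuot {suc m} 2 i in
      trans (action a b 0# 0# v u w)
        (trans (drop _ _ _) (solve 3 (λ a b e → a :* e :+ b :* (e :+ e) := (a :+ (b :+ b)) :* e) refl a b (δ v 0F)))

    Ay : ∀ i → _
    Ay i = let v , u = remQuot {suc m} 2 i in
      trans (action a b 0# 0# v u y)
        (trans (drop _ _ _) (+-congˡ (*-congˡ (trans (+-cong (zeroʳ _) (*-identityʳ _)) (+-identityˡ _)))))

    entry-zero : ∀ f → a * (0# * f) + b * 0# + 0# * f + 0# ≈ 0#
    entry-zero f = trans (+-identityʳ _) (trans
      (+-cong (trans (+-cong (trans (*-congˡ (zeroˡ f)) (zeroʳ a)) (zeroʳ b)) (+-identityˡ 0#)) (zeroˡ f)) (+-identityˡ 0#))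

    row₁ : ∀ j → pairMatrix (suc m) a b 0# 0# 1F (suc (suc j)) ≈ 0# + 1# * pairMatrix (suc m) a b 0# 0# 0F (suc (suc j))
    row₁ j = let v , u = remQuot {m} 2 j in
      trans (entry-zero (δ 1F u)) (sym (trans (+-identityˡ _) (trans (*-identityˡ _) (entry-zero (δ 0F u)))))

    rows : ∀ i j → pairMatrix m a b 0# 0# i j ≈ pairMatrix m a b 0# 0# i j + (0# * δ (proj₂ (remQuot {m} 2 i)) 1F) * 0#
      + 0# * pairMatrix (suc m) a b 0# 0# 0F (suc (suc j))
    rows i j = sym (trans (+-cong (trans (+-congˡ (zeroʳ _)) (+-identityʳ _)) (zeroˡ _)) (+-identityʳ _))

  -- The all-ones vector and the indicator y of u = 1 split off, and the blocks
  -- remain.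
  det-pairMatrix : ∀ m a b c d → let N = suc m ⊠ 1# in
    det (pairMatrix (suc m) a b c d) ≈ (a + (b + b) + N * c + (N * d + N * d)) * ((a + N * c) * ((a + (b + b)) * a) ^ m)
  det-pairMatrix m a b c d =
    trans (det-deflate₂ (pairMatrix (suc m) a b c d) (pairMatrix m a b 0# 0#)
             (a + (b + b) + N * c + (N * d + N * d)) (a + N * c) (b + N * d)
             (λ _ → 1#) (λ i → y (remQuot {suc m} 2 i)) q refl refl refl Aw Ay row₁ rows)
          (*-congˡ (*-congˡ (det-blocks m a b)))
    where
    N = suc m ⊠ 1#

    y : Fin (suc m) × Fin 2 → C
    y (v , u) = δ u 1F

    q : Vector C (m ℕ.* 2)
    q j = let v , u = remQuot {m} 2 j in c * δ 1F u - c * δ 0F u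

    q+ : ∀ (u : Fin 2) → c * δ 1F u - c * δ 0F u + c * δ 0F u ≈ c * δ 1F u
    q+ u = trans (+-assoc _ _ _) (trans (+-congˡ (-‿inverseˡ _)) (+-identityʳ _))

    Aw : ∀ i → _
    Aw i = let v , u = remQuot {suc m} 2 i in begin
      sum (λ k → entry a b c d (v , u) (remQuot {suc m} 2 k) * 1#)
        ≈⟨ action a b c d v u (λ _ → 1#) ⟩
      a * 1# + b * (1# + 1#) + (c * sum {suc m} (λ _ → 1#) + d * sum {suc m} (λ _ → 1# + 1#))
        ≈⟨ +-congˡ (+-cong (*-congˡ (sum-const (suc m) 1#)) (*-congˡ (sum-const (suc m) (1# + 1#)))) ⟩
      a * 1# + b * (1# + 1#) + (c * (N * 1#) + d * (N * (1# + 1#)))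
        ≈⟨ solve 6 (λ a b c d N o → a :* o :+ b :* (o :+ o) :+ (c :* (N :* o) :+ d :* (N :* (o :+ o)))
             := (a :+ (b :+ b) :+ N :* c :+ (N :* d :+ N :* d)) :* o) refl a b c d N 1# ⟩
      (a + (b + b) + N * c + (N * d + N * d)) * 1# ∎

    Ay : ∀ i → _
    Ay i = let v , u = remQuot {suc m} 2 i in begin
      sum (λ k → entry a b c d (v , u) (remQuot {suc m} 2 k) * y (remQuot {suc m} 2 k))
        ≈⟨ action a b c d v u y ⟩
      a * δ u 1F + b * (0# + 1#) + (c * sum {suc m} (λ _ → δ u 1F) + d * sum {suc m} (λ _ → 0# + 1#))
        ≈⟨ +-cong (+-congˡ (*-congˡ (+-identityˡ 1#)))
             (+-cong (*-congˡ (sum-const (suc m) (δ u 1F))) (*-congˡ (trans (sum-const (suc m) (0# + 1#)) (*-congˡ (+-identityˡ 1#))))) ⟩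
      a * δ u 1F + b * 1# + (c * (N * δ u 1F) + d * (N * 1#))
        ≈⟨ solve 7 (λ a b c d N o f → a :* f :+ b :* o :+ (c :* (N :* f) :+ d :* (N :* o))
             := (a :+ N :* c) :* f :+ (b :+ N :* d) :* o) refl a b c d N 1# (δ u 1F) ⟩
      (a + N * c) * δ u 1F + (b + N * d) * 1# ∎

    first : ∀ f → a * (0# * f) + b * 0# + c * f + d ≈ c * f + d
    first f = +-congʳ (trans (+-congʳ (trans (+-cong (trans (*-congˡ (zeroˡ f)) (zeroʳ a)) (zeroʳ b)) (+-identityˡ 0#))) (+-identityˡ _))

    row₁ : ∀ j → pairMatrix (suc m) a b c d 1F (suc (suc j)) ≈ q j + 1# * pairMatrix (suc m) a b c d 0F (suc (suc j))
    row₁ j = let v , u = remQuot {m} 2 j in begin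
      a * (0# * δ 1F u) + b * 0# + c * δ 1F u + d   ≈⟨ first (δ 1F u) ⟩
      c * δ 1F u + d                                ≈⟨ +-congʳ (q+ u) ⟨
      q j + c * δ 0F u + d                          ≈⟨ +-assoc _ _ _ ⟩
      q j + (c * δ 0F u + d)                        ≈⟨ +-congˡ (trans (*-identityˡ _) (first (δ 0F u))) ⟨
      q j + 1# * pairMatrix (suc m) a b c d 0F (suc (suc j)) ∎

    rows : ∀ i j → pairMatrix m a b c d i j ≈ pairMatrix m a b 0# 0# i j + δ (proj₂ (remQuot {m} 2 i)) 1F * q j
      + 1# * pairMatrix (suc m) a b c d 0F (suc (suc j))
    rows i j = let v , u = remQuot {m} 2 i; v′ , u′ = remQuot {m} 2 j; x = a * (δ v v′ * δ u u′) + b * δ v v′ in begin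
      x + c * δ u u′ + d
        ≈⟨ +-congʳ (+-congˡ (interpolate u u′)) ⟩
      x + (δ u 1F * q j + c * δ 0F u′) + d
        ≈⟨ solve 4 (λ x z f d → x :+ (z :+ f) :+ d := x :+ z :+ (f :+ d)) refl x (δ u 1F * q j) (c * δ 0F u′) d ⟩
      x + δ u 1F * q j + (c * δ 0F u′ + d)
        ≈⟨ +-cong (+-congʳ (sym (trans (+-identityʳ _) (trans (+-congˡ (zeroˡ _)) (+-identityʳ _)))))
                  (sym (trans (*-identityˡ _) (first (δ 0F u′)))) ⟩
      x + 0# * δ u u′ + 0# + δ u 1F * q j + 1# * pairMatrix (suc m) a b c d 0F (suc (suc j)) ∎
      where
      interpolate : ∀ (u u′ : Fin 2) → c * δ u u′ ≈ δ u 1F * (c * δ 1F u′ - c * δ 0F u′) + c * δ 0F u′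
      interpolate 0F u′ = sym (trans (+-congʳ (zeroˡ _)) (+-identityˡ _))
      interpolate 1F u′ = sym (trans (+-congʳ (*-identityˡ _)) (q+ u′))

-- Equality of vertices of the product, through their pairs.
does-≟-pair : ∀ n (i j : Fin (n ℕ.* 2)) →
  does (i Fin.≟ j) ≡ does (proj₁ (remQuot {n} 2 i) Fin.≟ proj₁ (remQuot {n} 2 j))
                     ∧ does (proj₂ (remQuot {n} 2 i) Fin.≟ proj₂ (remQuot {n} 2 j))
does-≟-pair (suc n) 0F 0F = ≡.refl
does-≟-pair (suc n) 0F 1F = ≡.refl
does-≟-pair (suc n) 0F (suc (suc j)) = ≡.refl
does-≟-pair (suc n) 1F 0F = ≡.refl
does-≟-pair (suc n) 1F 1F = ≡.refl
does-≟-pair (suc n) 1F (suc (suc j)) = ≡.refl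
does-≟-pair (suc n) (suc (suc i)) 0F = ≡.refl
does-≟-pair (suc n) (suc (suc i)) 1F = ≡.refl
does-≟-pair (suc n) (suc (suc i)) (suc (suc j)) = does-≟-pair n i j

-- The characteristic polynomial

-- Over any commutative ring with an element X and a homomorphism ι from the
-- rationals: the characteristic polynomial is the case of the polynomial ring, with
-- its X and with ι = constₚ.
module CharacteristicPolynomial (R : CommutativeRing 0ℓ 0ℓ) (X : CommutativeRing.Carrier R)
  (ι : ℚ → CommutativeRing.Carrier R)
  (ι-0 : CommutativeRing._≈_ R (ι 0ℚ) (CommutativeRing.0# R))
  (ι-1 : CommutativeRing._≈_ R (ι 1ℚ) (CommutativeRing.1# R))
  (ι-+ : ∀ x y → CommutativeRing._≈_ R (ι (x ℚ.+ y)) (CommutativeRing._+_ R (ι x) (ι y)))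
  (ι-* : ∀ x y → CommutativeRing._≈_ R (ι (x ℚ.* y)) (CommutativeRing._*_ R (ι x) (ι y)))
  where
  open CommutativeRing R hiding (zero) renaming (Carrier to C)
  open Determinants R using (det-cong)
  open PairMatrices R
  module ℚᴾ = PairMatrices ℚ.+-*-commutativeRing
  open import Algebra.Properties.Semiring.Mult (CommutativeRing.semiring ℚ.+-*-commutativeRing) using () renaming (_×_ to _⊠ℚ_)
  open import Algebra.Properties.Semiring.Mult semiring using () renaming (_×_ to _⊠_)
  open import Algebra.Properties.CommutativeSemiring.Exp commutativeSemiring using (_^_; ^-distrib-*; ^-congˡ)
  open import Algebra.Solver.Ring.NaturalCoefficients.Default commutativeSemiring
    using (solve; _:=_; _:+_; _:*_)
  open import Relation.Binary.Reasoning.Setoid setoid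
  open Determinant rawRing using (det)

  ι-⊠ : ∀ n → ι (n ⊠ℚ 1ℚ) ≈ n ⊠ 1#
  ι-⊠ zero    = ι-0
  ι-⊠ (suc n) = trans (ι-+ 1ℚ (n ⊠ℚ 1ℚ)) (+-cong ι-1 (ι-⊠ n))

  ι-δ : ∀ {n} (i j : Fin n) → ι (ℚᴾ.δ i j) ≈ δ i j
  ι-δ i j with does (i Fin.≟ j)
  ... | true  = ι-1
  ... | false = ι-0

  ι-entry : ∀ {n} a b c d (p q : Fin n × Fin 2) → ι (ℚᴾ.entry a b c d p q) ≈ entry (ι a) (ι b) (ι c) (ι d) p q
  ι-entry a b c d (v , u) (v′ , u′) =
    trans (ι-+ _ _) (+-congʳ (trans (ι-+ _ _) (+-cong (trans (ι-+ _ _) (+-cong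
      (trans (ι-* _ _) (*-congˡ (trans (ι-* _ _) (*-cong (ι-δ v v′) (ι-δ u u′)))))
      (trans (ι-* _ _) (*-congˡ (ι-δ v v′)))))
      (trans (ι-* _ _) (*-congˡ (ι-δ u u′))))))

  -- If -A has the parameters a b c d, then X I - A has X + a, b, c, d.
  charMatrix-entry : ∀ n {a b c d} {A : Matrix ℚ (n ℕ.* 2) (n ℕ.* 2)} →
    (∀ i j → ℚ.- A i j ≡ ℚᴾ.pairMatrix n a b c d i j) → ∀ i j →
    (if does (i Fin.≟ j) then X else 0#) + ι (ℚ.- A i j) ≈ pairMatrix n (X + ι a) (ι b) (ι c) (ι d) i j
  charMatrix-entry n {a} {b} {c} {d} {A} -A i j = begin
    (if does (i Fin.≟ j) then X else 0#) + ι (ℚ.- A i j)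
      ≈⟨ +-cong (reflexive (≡.cong (if_then X else 0#) (does-≟-pair n i j))) (reflexive (≡.cong ι (-A i j))) ⟩
    (if does (v Fin.≟ v′) ∧ does (u Fin.≟ u′) then X else 0#) + ι (ℚᴾ.pairMatrix n a b c d i j)
      ≈⟨ +-cong (if-∧ (does (v Fin.≟ v′)) (does (u Fin.≟ u′))) (ι-entry a b c d (v , u) (v′ , u′)) ⟩
    X * (δ v v′ * δ u u′) + entry (ι a) (ι b) (ι c) (ι d) (v , u) (v′ , u′)
      ≈⟨ solve 7 (λ X a b c d e f → X :* (e :* f) :+ (a :* (e :* f) :+ b :* e :+ c :* f :+ d)
           := (X :+ a) :* (e :* f) :+ b :* e :+ c :* f :+ d) refl X (ι a) (ι b) (ι c) (ι d) (δ v v′) (δ u u′) ⟩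
    entry (X + ι a) (ι b) (ι c) (ι d) (v , u) (v′ , u′) ∎
    where
    v = proj₁ (remQuot {n} 2 i)
    u = proj₂ (remQuot {n} 2 i)
    v′ = proj₁ (remQuot {n} 2 j)
    u′ = proj₂ (remQuot {n} 2 j)

    if-∧ : ∀ x y → (if x ∧ y then X else 0#) ≈ X * ((if x then 1# else 0#) * (if y then 1# else 0#))
    if-∧ true  true  = sym (trans (*-congˡ (*-identityˡ 1#)) (*-identityʳ X))
    if-∧ true  false = sym (trans (*-congˡ (zeroʳ 1#)) (zeroʳ X))
    if-∧ false y     = sym (trans (*-congˡ (zeroˡ _)) (zeroʳ X))

  -- The product of the linear factors X - μ.
  product : List ℚ → C
  product = foldr (λ μ p → (X + ι (ℚ.- μ)) * p) 1#

  product-replicate : ∀ m μ λs → product (replicate m μ ++ λs) ≈ (X + ι (ℚ.- μ)) ^ m * product λs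
  product-replicate zero    μ λs = sym (*-identityˡ _)
  product-replicate (suc m) μ λs = trans (*-congˡ (product-replicate m μ λs)) (sym (*-assoc _ _ _))

  product-replicate′ : ∀ m μ → product (replicate m μ) ≈ (X + ι (ℚ.- μ)) ^ m
  product-replicate′ zero    μ = refl
  product-replicate′ (suc m) μ = *-congˡ (product-replicate′ m μ)

  -- The eigenvalues of A, when -A has the parameters a b c d.
  det-charMatrix : ∀ m a b c d {s t p q} {A : Matrix ℚ (suc m ℕ.* 2) (suc m ℕ.* 2)} → let N = suc m ⊠ℚ 1ℚ in
    (∀ i j → ℚ.- A i j ≡ ℚᴾ.pairMatrix (suc m) a b c d i j) →
    ℚ.- s ≡ a ℚ.+ (b ℚ.+ b) ℚ.+ N ℚ.* c ℚ.+ (N ℚ.* d ℚ.+ N ℚ.* d) →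
    ℚ.- t ≡ a ℚ.+ N ℚ.* c →
    ℚ.- p ≡ a ℚ.+ (b ℚ.+ b) →
    ℚ.- q ≡ a →
    det (λ i j → (if does (i Fin.≟ j) then X else 0#) + ι (ℚ.- A i j))
    ≈ product (s ∷ replicate m p ++ t ∷ replicate m q)
  det-charMatrix m a b c d {s} {t} {p} {q} {A} -A s≡ t≡ p≡ q≡ = begin
    det (λ i j → (if does (i Fin.≟ j) then X else 0#) + ι (ℚ.- A i j))
      ≈⟨ det-cong (λ i j → (if does (i Fin.≟ j) then X else 0#) + ι (ℚ.- A i j))
           (pairMatrix (suc m) (X + ι a) (ι b) (ι c) (ι d)) (charMatrix-entry (suc m) {A = A} -A) ⟩
    det (pairMatrix (suc m) (X + ι a) (ι b) (ι c) (ι d))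
      ≈⟨ det-pairMatrix m (X + ι a) (ι b) (ι c) (ι d) ⟩
    (X + ι a + (ι b + ι b) + N * ι c + (N * ι d + N * ι d))
      * ((X + ι a + N * ι c) * ((X + ι a + (ι b + ι b)) * (X + ι a)) ^ m)
      ≈⟨ *-cong S≈ (*-cong T≈ (^-congˡ m (*-cong P≈ Q≈))) ⟩
    factor s * (factor t * (factor p * factor q) ^ m)
      ≈⟨ *-congˡ (*-congˡ (^-distrib-* (factor p) (factor q) m)) ⟩
    factor s * (factor t * (factor p ^ m * factor q ^ m))
      ≈⟨ *-congˡ (solve 3 (λ t p q → t :* (p :* q) := p :* (t :* q)) refl (factor t) (factor p ^ m) (factor q ^ m)) ⟩
    factor s * (factor p ^ m * (factor t * factor q ^ m))
      ≈⟨ *-congˡ (trans (product-replicate m p (t ∷ replicate m q)) (*-congˡ (*-congˡ (product-replicate′ m q)))) ⟨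
    product (s ∷ replicate m p ++ t ∷ replicate m q) ∎
    where
    N = suc m ⊠ 1#
    Nℚ = suc m ⊠ℚ 1ℚ

    factor : ℚ → C
    factor μ = X + ι (ℚ.- μ)

    ι-N : ∀ x → N * ι x ≈ ι (Nℚ ℚ.* x)
    ι-N x = sym (trans (ι-* Nℚ x) (*-congʳ (ι-⊠ (suc m))))

    collect : ∀ {x y} → ℚ.- x ≡ y → X + ι y ≈ factor x
    collect eq = +-congˡ (reflexive (≡.cong ι (≡.sym eq)))

    absorb : ∀ x {y z} → z ≈ ι y → X + ι x + z ≈ X + ι (x ℚ.+ y)
    absorb x {y} z≈ = trans (+-assoc X (ι x) _) (+-congˡ (trans (+-congˡ z≈) (sym (ι-+ x y))))

    Q≈ : X + ι a ≈ factor q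
    Q≈ = collect q≡

    P≈′ : X + ι a + (ι b + ι b) ≈ X + ι (a ℚ.+ (b ℚ.+ b))
    P≈′ = absorb a (sym (ι-+ b b))

    P≈ : X + ι a + (ι b + ι b) ≈ factor p
    P≈ = trans P≈′ (collect p≡)

    T≈ : X + ι a + N * ι c ≈ factor t
    T≈ = trans (absorb a (ι-N c)) (collect t≡)

    S≈ : X + ι a + (ι b + ι b) + N * ι c + (N * ι d + N * ι d) ≈ factor s
    S≈ = trans (+-congʳ (trans (+-congʳ P≈′) (absorb _ (ι-N c))))
           (trans (absorb _ (trans (+-cong (ι-N d) (ι-N d)) (sym (ι-+ _ _)))) (collect s≡))

-- The ring of polynomials

module Polynomials where
  open import Data.Rational using (_+_; _*_; -_)
  open import Relation.Binary.PropositionalEquality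
    using (refl; sym; trans; cong; cong₂; module ≡-Reasoning)
  open ℚ.+-*-Solver
  open ≡-Reasoning

  coeff-+ : ∀ p q k → coeff (p +ₚ q) k ≡ coeff p k + coeff q k
  coeff-+ []      q       k       = sym (ℚ.+-identityˡ _)
  coeff-+ (a ∷ p) []      k       = sym (ℚ.+-identityʳ _)
  coeff-+ (a ∷ p) (b ∷ q) zero    = refl
  coeff-+ (a ∷ p) (b ∷ q) (suc k) = coeff-+ p q k

  coeff-neg : ∀ p k → coeff (map (-_) p) k ≡ - coeff p k
  coeff-neg []      k       = refl
  coeff-neg (a ∷ p) zero    = refl
  coeff-neg (a ∷ p) (suc k) = coeff-neg p k

  coeff-scale : ∀ a q k → coeff (map (a *_) q) k ≡ a * coeff q k
  coeff-scale a []      k       = sym (ℚ.*-zeroʳ a)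
  coeff-scale a (b ∷ q) zero    = refl
  coeff-scale a (b ∷ q) (suc k) = coeff-scale a q k

  coeff-*-zero : ∀ a p q → coeff ((a ∷ p) *ₚ q) 0 ≡ a * coeff q 0
  coeff-*-zero a p q =
    trans (coeff-+ (map (a *_) q) _ 0) (trans (ℚ.+-identityʳ _) (coeff-scale a q 0))

  coeff-*-suc : ∀ a p q k → coeff ((a ∷ p) *ₚ q) (suc k) ≡ a * coeff q (suc k) + coeff (p *ₚ q) k
  coeff-*-suc a p q k =
    trans (coeff-+ (map (a *_) q) _ (suc k)) (cong (_+ coeff (p *ₚ q) k) (coeff-scale a q (suc k)))

  *-congʳ : ∀ p {q r} → q ≈ₚ r → p *ₚ q ≈ₚ p *ₚ r
  *-congʳ []      q≈r k = refl
  *-congʳ (a ∷ p) {q} {r} q≈r zero =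
    trans (coeff-*-zero a p q) (trans (cong (a *_) (q≈r 0)) (sym (coeff-*-zero a p r)))
  *-congʳ (a ∷ p) {q} {r} q≈r (suc k) =
    trans (coeff-*-suc a p q k)
      (trans (cong₂ (λ x y → a * x + y) (q≈r (suc k)) (*-congʳ p q≈r k)) (sym (coeff-*-suc a p r k)))

  *-zeroʳ : ∀ p → p *ₚ [] ≈ₚ []
  *-zeroʳ []      k       = refl
  *-zeroʳ (a ∷ p) zero    = refl
  *-zeroʳ (a ∷ p) (suc k) = *-zeroʳ p k

  coeff-*-∷-zero : ∀ p b q → coeff (p *ₚ (b ∷ q)) 0 ≡ b * coeff p 0
  coeff-*-∷-zero []      b q = sym (ℚ.*-zeroʳ b)
  coeff-*-∷-zero (a ∷ p) b q = trans (coeff-*-zero a p (b ∷ q)) (ℚ.*-comm a b)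

  coeff-*-∷-suc : ∀ p b q k → coeff (p *ₚ (b ∷ q)) (suc k) ≡ b * coeff p (suc k) + coeff (p *ₚ q) k
  coeff-*-∷-suc []      b q k = sym (trans (ℚ.+-identityʳ _) (ℚ.*-zeroʳ b))
  coeff-*-∷-suc (a ∷ p) b q zero = begin
    coeff ((a ∷ p) *ₚ (b ∷ q)) 1            ≡⟨ coeff-*-suc a p (b ∷ q) 0 ⟩
    a * coeff q 0 + coeff (p *ₚ (b ∷ q)) 0  ≡⟨ cong₂ _+_ (sym (coeff-*-zero a p q)) (coeff-*-∷-zero p b q) ⟩
    coeff ((a ∷ p) *ₚ q) 0 + b * coeff p 0  ≡⟨ ℚ.+-comm _ (b * coeff p 0) ⟩
    b * coeff p 0 + coeff ((a ∷ p) *ₚ q) 0  ∎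
  coeff-*-∷-suc (a ∷ p) b q (suc k) = begin
    coeff ((a ∷ p) *ₚ (b ∷ q)) (suc (suc k))
      ≡⟨ coeff-*-suc a p (b ∷ q) (suc k) ⟩
    a * coeff q (suc k) + coeff (p *ₚ (b ∷ q)) (suc k)
      ≡⟨ cong (a * coeff q (suc k) +_) (coeff-*-∷-suc p b q k) ⟩
    a * coeff q (suc k) + (b * coeff p (suc k) + coeff (p *ₚ q) k)
      ≡⟨ solve 3 (λ x y z → x :+ (y :+ z) := y :+ (x :+ z)) refl (a * coeff q (suc k)) (b * coeff p (suc k)) (coeff (p *ₚ q) k) ⟩
    b * coeff p (suc k) + (a * coeff q (suc k) + coeff (p *ₚ q) k)
      ≡⟨ cong (b * coeff p (suc k) +_) (coeff-*-suc a p q k) ⟨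
    b * coeff p (suc k) + coeff ((a ∷ p) *ₚ q) (suc k) ∎

  *-comm : ∀ p q → p *ₚ q ≈ₚ q *ₚ p
  *-comm p []      k       = *-zeroʳ p k
  *-comm p (b ∷ q) zero    = trans (coeff-*-∷-zero p b q) (sym (coeff-*-zero b q p))
  *-comm p (b ∷ q) (suc k) =
    trans (coeff-*-∷-suc p b q k)
      (trans (cong (b * coeff p (suc k) +_) (*-comm p q k)) (sym (coeff-*-suc b q p k)))

  *-cong : ∀ {p q r s} → p ≈ₚ q → r ≈ₚ s → p *ₚ r ≈ₚ q *ₚ s
  *-cong {p} {q} {r} {s} p≈q r≈s k = begin
    coeff (p *ₚ r) k  ≡⟨ *-congʳ p r≈s k ⟩
    coeff (p *ₚ s) k  ≡⟨ *-comm p s k ⟩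
    coeff (s *ₚ p) k  ≡⟨ *-congʳ s p≈q k ⟩
    coeff (s *ₚ q) k  ≡⟨ *-comm s q k ⟩
    coeff (q *ₚ s) k  ∎

  coeff-distribʳ : ∀ r p q k → coeff ((p +ₚ q) *ₚ r) k ≡ coeff (p *ₚ r) k + coeff (q *ₚ r) k
  coeff-distribʳ r []      q       k = sym (ℚ.+-identityˡ _)
  coeff-distribʳ r (a ∷ p) []      k = sym (ℚ.+-identityʳ _)
  coeff-distribʳ r (a ∷ p) (b ∷ q) zero = begin
    coeff ((a + b ∷ p +ₚ q) *ₚ r) 0                  ≡⟨ coeff-*-zero (a + b) (p +ₚ q) r ⟩
    (a + b) * coeff r 0                              ≡⟨ ℚ.*-distribʳ-+ (coeff r 0) a b ⟩
    a * coeff r 0 + b * coeff r 0                    ≡⟨ cong₂ _+_ (coeff-*-zero a p r) (coeff-*-zero b q r) ⟨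
    coeff ((a ∷ p) *ₚ r) 0 + coeff ((b ∷ q) *ₚ r) 0  ∎
  coeff-distribʳ r (a ∷ p) (b ∷ q) (suc k) = begin
    coeff ((a + b ∷ p +ₚ q) *ₚ r) (suc k)
      ≡⟨ coeff-*-suc (a + b) (p +ₚ q) r k ⟩
    (a + b) * coeff r (suc k) + coeff ((p +ₚ q) *ₚ r) k
      ≡⟨ cong ((a + b) * coeff r (suc k) +_) (coeff-distribʳ r p q k) ⟩
    (a + b) * coeff r (suc k) + (coeff (p *ₚ r) k + coeff (q *ₚ r) k)
      ≡⟨ solve 5 (λ a b x y z → (a :+ b) :* x :+ (y :+ z) := (a :* x :+ y) :+ (b :* x :+ z)) refl
           a b (coeff r (suc k)) (coeff (p *ₚ r) k) (coeff (q *ₚ r) k) ⟩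
    (a * coeff r (suc k) + coeff (p *ₚ r) k) + (b * coeff r (suc k) + coeff (q *ₚ r) k)
      ≡⟨ cong₂ _+_ (coeff-*-suc a p r k) (coeff-*-suc b q r k) ⟨
    coeff ((a ∷ p) *ₚ r) (suc k) + coeff ((b ∷ q) *ₚ r) (suc k) ∎

  coeff-scale-* : ∀ a p r k → coeff (map (a *_) p *ₚ r) k ≡ a * coeff (p *ₚ r) k
  coeff-scale-* a []      r k = sym (ℚ.*-zeroʳ a)
  coeff-scale-* a (b ∷ p) r zero =
    trans (coeff-*-zero (a * b) (map (a *_) p) r)
      (trans (ℚ.*-assoc a b _) (cong (a *_) (sym (coeff-*-zero b p r))))
  coeff-scale-* a (b ∷ p) r (suc k) = begin
    coeff ((a * b ∷ map (a *_) p) *ₚ r) (suc k)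
      ≡⟨ coeff-*-suc (a * b) (map (a *_) p) r k ⟩
    a * b * coeff r (suc k) + coeff (map (a *_) p *ₚ r) k
      ≡⟨ cong (a * b * coeff r (suc k) +_) (coeff-scale-* a p r k) ⟩
    a * b * coeff r (suc k) + a * coeff (p *ₚ r) k
      ≡⟨ solve 4 (λ a b x y → a :* b :* x :+ a :* y := a :* (b :* x :+ y)) refl a b (coeff r (suc k)) (coeff (p *ₚ r) k) ⟩
    a * (b * coeff r (suc k) + coeff (p *ₚ r) k)
      ≡⟨ cong (a *_) (coeff-*-suc b p r k) ⟨
    a * coeff ((b ∷ p) *ₚ r) (suc k) ∎

  *-assoc : ∀ p q r → (p *ₚ q) *ₚ r ≈ₚ p *ₚ (q *ₚ r)
  *-assoc []      q r k = refl
  *-assoc (a ∷ p) q r k = trans (coeff-distribʳ r (map (a *_) q) (0ℚ ∷ p *ₚ q) k)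
      (trans (cong (_+ coeff ((0ℚ ∷ p *ₚ q) *ₚ r) k) (coeff-scale-* a q r k)) (shifted k))
    where
    shifted : ∀ k → a * coeff (q *ₚ r) k + coeff ((0ℚ ∷ p *ₚ q) *ₚ r) k ≡ coeff ((a ∷ p) *ₚ (q *ₚ r)) k
    shifted zero = begin
      a * coeff (q *ₚ r) 0 + coeff ((0ℚ ∷ p *ₚ q) *ₚ r) 0  ≡⟨ cong (a * coeff (q *ₚ r) 0 +_) (trans (coeff-*-zero 0ℚ (p *ₚ q) r) (ℚ.*-zeroˡ (coeff r 0))) ⟩
      a * coeff (q *ₚ r) 0 + 0ℚ                            ≡⟨ ℚ.+-identityʳ _ ⟩
      a * coeff (q *ₚ r) 0                                 ≡⟨ coeff-*-zero a p (q *ₚ r) ⟨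
      coeff ((a ∷ p) *ₚ (q *ₚ r)) 0                        ∎
    shifted (suc k) = begin
      a * coeff (q *ₚ r) (suc k) + coeff ((0ℚ ∷ p *ₚ q) *ₚ r) (suc k)
        ≡⟨ cong (a * coeff (q *ₚ r) (suc k) +_) (trans (coeff-*-suc 0ℚ (p *ₚ q) r k)
             (trans (cong (_+ coeff ((p *ₚ q) *ₚ r) k) (ℚ.*-zeroˡ (coeff r (suc k)))) (ℚ.+-identityˡ _))) ⟩
      a * coeff (q *ₚ r) (suc k) + coeff ((p *ₚ q) *ₚ r) k
        ≡⟨ cong (a * coeff (q *ₚ r) (suc k) +_) (*-assoc p q r k) ⟩
      a * coeff (q *ₚ r) (suc k) + coeff (p *ₚ (q *ₚ r)) k
        ≡⟨ coeff-*-suc a p (q *ₚ r) k ⟨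
      coeff ((a ∷ p) *ₚ (q *ₚ r)) (suc k) ∎

  *-identityˡ : ∀ p → constₚ 1ℚ *ₚ p ≈ₚ p
  *-identityˡ p zero    = trans (coeff-*-zero 1ℚ [] p) (ℚ.*-identityˡ _)
  *-identityˡ p (suc k) = trans (coeff-*-suc 1ℚ [] p k) (trans (ℚ.+-identityʳ _) (ℚ.*-identityˡ _))

  *-distribʳ : ∀ r p q → (p +ₚ q) *ₚ r ≈ₚ p *ₚ r +ₚ q *ₚ r
  *-distribʳ r p q k = trans (coeff-distribʳ r p q k) (sym (coeff-+ (p *ₚ r) (q *ₚ r) k))

  +-cong : ∀ {p q r s} → p ≈ₚ q → r ≈ₚ s → p +ₚ r ≈ₚ q +ₚ s
  +-cong {p} {q} {r} {s} p≈q r≈s k =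
    trans (coeff-+ p r k) (trans (cong₂ _+_ (p≈q k) (r≈s k)) (sym (coeff-+ q s k)))

  +-comm : ∀ p q → p +ₚ q ≈ₚ q +ₚ p
  +-comm p q k = trans (coeff-+ p q k) (trans (ℚ.+-comm _ (coeff q k)) (sym (coeff-+ q p k)))

  +-assoc : ∀ p q r → (p +ₚ q) +ₚ r ≈ₚ p +ₚ (q +ₚ r)
  +-assoc p q r k = begin
    coeff ((p +ₚ q) +ₚ r) k                ≡⟨ trans (coeff-+ (p +ₚ q) r k) (cong (_+ coeff r k) (coeff-+ p q k)) ⟩
    coeff p k + coeff q k + coeff r k      ≡⟨ ℚ.+-assoc (coeff p k) _ _ ⟩
    coeff p k + (coeff q k + coeff r k)    ≡⟨ trans (coeff-+ p (q +ₚ r) k) (cong (coeff p k +_) (coeff-+ q r k)) ⟨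
    coeff (p +ₚ (q +ₚ r)) k                ∎

  +-identityʳ : ∀ p → p +ₚ [] ≈ₚ p
  +-identityʳ p k = trans (coeff-+ p [] k) (ℚ.+-identityʳ _)

  -‿inverseˡ : ∀ p → map (-_) p +ₚ p ≈ₚ []
  -‿inverseˡ p k =
    trans (coeff-+ (map (-_) p) p k) (trans (cong (_+ coeff p k) (coeff-neg p k)) (ℚ.+-inverseˡ (coeff p k)))

  polyRing : CommutativeRing 0ℓ 0ℓ
  polyRing = record
    { Carrier = Poly
    ; _≈_ = _≈ₚ_
    ; _+_ = _+ₚ_
    ; _*_ = _*ₚ_
    ; -_ = map (-_)
    ; 0# = []
    ; 1# = constₚ 1ℚ
    ; isCommutativeRing = record
      { isRing = record
        { +-isAbelianGroup = record
          { isGroup = record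
            { isMonoid = record
              { isSemigroup = record
                { isMagma = record
                  { isEquivalence = record
                    { refl = λ k → refl
                    ; sym = λ p≈q k → sym (p≈q k)
                    ; trans = λ p≈q q≈r k → trans (p≈q k) (q≈r k) }
                  ; ∙-cong = λ {p} {q} {r} {s} → +-cong {p} {q} {r} {s} }
                ; assoc = +-assoc }
              ; identity = (λ p k → refl) , +-identityʳ }
            ; inverse = -‿inverseˡ , λ p k → trans (+-comm p (map (-_) p) k) (-‿inverseˡ p k)
            ; ⁻¹-cong = λ {p} {q} p≈q k → trans (coeff-neg p k) (trans (cong (-_) (p≈q k)) (sym (coeff-neg q k))) }
          ; comm = +-comm }
        ; *-cong = λ {p} {q} {r} {s} → *-cong {p} {q} {r} {s}
        ; *-assoc = *-assoc
        ; *-identity = *-identityˡ , λ p k → trans (*-comm p (constₚ 1ℚ) k) (*-identityˡ p k)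
        ; distrib = (λ r p q k → begin
              coeff (r *ₚ (p +ₚ q)) k       ≡⟨ *-comm r (p +ₚ q) k ⟩
              coeff ((p +ₚ q) *ₚ r) k       ≡⟨ *-distribʳ r p q k ⟩
              coeff (p *ₚ r +ₚ q *ₚ r) k    ≡⟨ +-cong {p *ₚ r} {r *ₚ p} {q *ₚ r} {r *ₚ q} (*-comm p r) (*-comm q r) k ⟩
              coeff (r *ₚ p +ₚ r *ₚ q) k    ∎)
          , *-distribʳ }
      ; *-comm = *-comm } }

  const-0 : constₚ 0ℚ ≈ₚ []
  const-0 zero    = refl
  const-0 (suc k) = refl

  const-* : ∀ a b → constₚ (a * b) ≈ₚ constₚ a *ₚ constₚ b
  const-* a b zero    = sym (ℚ.+-identityʳ (a * b))
  const-* a b (suc k) = refl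

-- Matrices over the rationals

module RationalMatrices where
  open import Data.Rational using (_+_; _*_; _-_; -_)
  open import Data.Integer using (+_)
  open import Relation.Binary.PropositionalEquality
    using (refl; sym; trans; cong; cong₂; module ≡-Reasoning)
  open import Algebra.Properties.Semiring.Sum (CommutativeRing.semiring ℚ.+-*-commutativeRing)
  open import Algebra.Properties.Semiring.Mult (CommutativeRing.semiring ℚ.+-*-commutativeRing)
    using () renaming (_×_ to _⊠_)
  open PairMatrices ℚ.+-*-commutativeRing
  open ≡-Reasoning

  ⊗-assoc : ∀ {m n p q} (A : Matrix ℚ m n) (B : Matrix ℚ n p) (D : Matrix ℚ p q) → A ⊗ B ⊗ D ≐ A ⊗ (B ⊗ D)
  ⊗-assoc A B D i j = begin
    sum (λ l → sum (λ k → A i k * B k l) * D l j)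
      ≡⟨ sum-cong-≗ (λ l → *-distribʳ-sum (D l j) (λ k → A i k * B k l)) ⟩
    sum (λ l → sum (λ k → A i k * B k l * D l j))
      ≡⟨ ∑-comm (λ l k → A i k * B k l * D l j) ⟩
    sum (λ k → sum (λ l → A i k * B k l * D l j))
      ≡⟨ sum-cong-≗ (λ k → trans (sum-cong-≗ λ l → ℚ.*-assoc (A i k) (B k l) (D l j)) (sym (*-distribˡ-sum (A i k) (λ l → B k l * D l j)))) ⟩
    sum (λ k → A i k * sum (λ l → B k l * D l j)) ∎

  ⊗-cong : ∀ {m n p} {A A′ : Matrix ℚ m n} {B B′ : Matrix ℚ n p} → A ≐ A′ → B ≐ B′ → A ⊗ B ≐ A′ ⊗ B′
  ⊗-cong A≐A′ B≐B′ i j = sum-cong-≗ λ k → cong₂ _*_ (A≐A′ i k) (B≐B′ k j)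

  Symmetric : ∀ {n} → Matrix ℚ n n → Set
  Symmetric A = A ᵀ ≐ A

  -- Symmetric factors: the transpose of a product is the product in reverse order.
  ⊗-swap : ∀ {n} (P Q : Matrix ℚ n n) → Symmetric P → Symmetric Q → ∀ i j → (P ⊗ Q) i j ≡ (Q ⊗ P) j i
  ⊗-swap P Q P-symm Q-symm i j = sum-cong-≗ λ k → begin
    P i k * Q k j  ≡⟨ ℚ.*-comm (P i k) (Q k j) ⟩
    Q k j * P i k  ≡⟨ cong₂ _*_ (Q-symm j k) (P-symm k i) ⟩
    Q j k * P k i  ∎

  -- If G and H are Moore–Penrose inverses of A, then A ⊗ G and A ⊗ H are symmetric
  -- idempotents with the same image, so they are equal; G ⊗ A and H ⊗ A are equal
  -- because they have the same kernel.
  -- Hence H = H A H = G A H = G A G = G.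
  moorePenrose-unique : ∀ {m n} {A : Matrix ℚ m n} {G H : Matrix ℚ n m} →
    IsMoorePenroseInverse A G → IsMoorePenroseInverse A H → H ≐ G
  moorePenrose-unique {A = A} {G} {H} AG AH i j = begin
    H i j                ≡⟨ H′.A†AA†≐A† i j ⟨
    (H ⊗ A ⊗ H) i j      ≡⟨ ⊗-cong {A = H ⊗ A} {G ⊗ A} {H} {H} HA≐GA (λ _ _ → refl) i j ⟩
    (G ⊗ A ⊗ H) i j      ≡⟨ ⊗-assoc G A H i j ⟩
    (G ⊗ (A ⊗ H)) i j    ≡⟨ ⊗-cong {A = G} {G} {A ⊗ H} {A ⊗ G} (λ _ _ → refl) AH≐AG i j ⟩
    (G ⊗ (A ⊗ G)) i j    ≡⟨ ⊗-assoc G A G i j ⟨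
    (G ⊗ A ⊗ G) i j      ≡⟨ G′.A†AA†≐A† i j ⟩
    G i j                ∎
    where
    module G′ = IsMoorePenroseInverse AG
    module H′ = IsMoorePenroseInverse AH

    absorb : ∀ {K K′} → A ⊗ K ⊗ A ≐ A → A ⊗ K ⊗ (A ⊗ K′) ≐ A ⊗ K′
    absorb {K} {K′} AKA i j = trans (sym (⊗-assoc (A ⊗ K) A K′ i j)) (⊗-cong {A = A ⊗ K ⊗ A} {A} {K′} {K′} AKA (λ _ _ → refl) i j)

    absorb′ : ∀ {K K′} → A ⊗ K ⊗ A ≐ A → K′ ⊗ A ⊗ (K ⊗ A) ≐ K′ ⊗ A
    absorb′ {K} {K′} AKA i j = begin
      (K′ ⊗ A ⊗ (K ⊗ A)) i j    ≡⟨ ⊗-assoc K′ A (K ⊗ A) i j ⟩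
      (K′ ⊗ (A ⊗ (K ⊗ A))) i j  ≡⟨ ⊗-cong {A = K′} {K′} {A ⊗ (K ⊗ A)} {A} (λ _ _ → refl) (λ k l → trans (sym (⊗-assoc A K A k l)) (AKA k l)) i j ⟩
      (K′ ⊗ A) i j              ∎

    AH≐AG : A ⊗ H ≐ A ⊗ G
    AH≐AG i j = begin
      (A ⊗ H) i j              ≡⟨ absorb {G} {H} G′.AA†A≐A i j ⟨
      (A ⊗ G ⊗ (A ⊗ H)) i j    ≡⟨ ⊗-swap (A ⊗ G) (A ⊗ H) G′.AA†-symm H′.AA†-symm i j ⟩
      (A ⊗ H ⊗ (A ⊗ G)) j i    ≡⟨ absorb {H} {G} H′.AA†A≐A j i ⟩
      (A ⊗ G) j i              ≡⟨ G′.AA†-symm i j ⟩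
      (A ⊗ G) i j              ∎

    HA≐GA : H ⊗ A ≐ G ⊗ A
    HA≐GA i j = begin
      (H ⊗ A) i j              ≡⟨ absorb′ {G} {H} G′.AA†A≐A i j ⟨
      (H ⊗ A ⊗ (G ⊗ A)) i j    ≡⟨ ⊗-swap (H ⊗ A) (G ⊗ A) H′.A†A-symm G′.A†A-symm i j ⟩
      (G ⊗ A ⊗ (H ⊗ A)) j i    ≡⟨ absorb′ {H} {G} H′.AA†A≐A j i ⟩
      (G ⊗ A) j i              ≡⟨ G′.A†A-symm i j ⟩
      (G ⊗ A) i j              ∎

  -- Fractions

  fromℚᵘ-+ : ∀ p q → fromℚᵘ (p ℚᵘ.+ q) ≡ fromℚᵘ p + fromℚᵘ q
  fromℚᵘ-+ p q = ℚ.toℚᵘ-injective (ℚᵘ.≃-trans (ℚ.toℚᵘ-fromℚᵘ (p ℚᵘ.+ q))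
    (ℚᵘ.≃-sym (ℚᵘ.≃-trans (ℚ.toℚᵘ-homo-+ (fromℚᵘ p) (fromℚᵘ q)) (ℚᵘ.+-cong (ℚ.toℚᵘ-fromℚᵘ p) (ℚ.toℚᵘ-fromℚᵘ q)))))

  fromℚᵘ-* : ∀ p q → fromℚᵘ (p ℚᵘ.* q) ≡ fromℚᵘ p * fromℚᵘ q
  fromℚᵘ-* p q = ℚ.toℚᵘ-injective (ℚᵘ.≃-trans (ℚ.toℚᵘ-fromℚᵘ (p ℚᵘ.* q))
    (ℚᵘ.≃-sym (ℚᵘ.≃-trans (ℚ.toℚᵘ-homo-* (fromℚᵘ p) (fromℚᵘ q)) (ℚᵘ.*-cong (ℚ.toℚᵘ-fromℚᵘ p) (ℚ.toℚᵘ-fromℚᵘ q)))))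

  /1-+ : ∀ i j → (i ℤ.+ j) / 1 ≡ i / 1 + j / 1
  /1-+ i j = trans (ℚ.fromℚᵘ-cong {mkℚᵘ (i ℤ.+ j) 0} {mkℚᵘ i 0 ℚᵘ.+ mkℚᵘ j 0} (*≡*
      (solve 2 (λ i j → (i :+ j) :* con (+ 1) := (i :* con (+ 1) :+ j :* con (+ 1)) :* con (+ 1)) refl i j)))
    (fromℚᵘ-+ (mkℚᵘ i 0) (mkℚᵘ j 0))
    where open ℤ.+-*-Solver

  /1-* : ∀ i j → (i ℤ.* j) / 1 ≡ (i / 1) * (j / 1)
  /1-* i j = fromℚᵘ-* (mkℚᵘ i 0) (mkℚᵘ j 0)

  /-cancel : ∀ i n .{{_ : NonZero n}} → (i / n) * (+ n / 1) ≡ i / 1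
  /-cancel i (suc n) = trans (sym (fromℚᵘ-* (mkℚᵘ i n) (mkℚᵘ (+ suc n) 0)))
    (ℚ.fromℚᵘ-cong {mkℚᵘ i n ℚᵘ.* mkℚᵘ (+ suc n) 0} {mkℚᵘ i 0} (*≡*
      (trans (ℤ.*-identityʳ _) (cong (λ k → i ℤ.* + k) (sym (ℕ.*-identityʳ (suc n)))))))

  -- A fraction in terms of an inverse x of its denominator.
  /-inverse : ∀ i n .{{_ : NonZero n}} x → (+ n / 1) * x ≡ 1ℚ → i / n ≡ (i / 1) * x
  /-inverse i n x nx≡1 = begin
    i / n                    ≡⟨ ℚ.*-identityʳ (i / n) ⟨
    (i / n) * 1ℚ             ≡⟨ cong ((i / n) *_) nx≡1 ⟨
    (i / n) * ((+ n / 1) * x) ≡⟨ ℚ.*-assoc (i / n) (+ n / 1) x ⟨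
    (i / n) * (+ n / 1) * x  ≡⟨ cong (_* x) (/-cancel i n) ⟩
    (i / 1) * x              ∎

  -- The sum of n ones, which the matrix lemmas use for the scalar n.
  ×1≡/1 : ∀ n → n ⊠ 1ℚ ≡ + n / 1
  ×1≡/1 zero    = refl
  ×1≡/1 (suc n) = trans (cong (λ x → 1ℚ + x) (×1≡/1 n)) (sym (/1-+ (+ 1) (+ n)))

  -- The Laplacian of the product graph

  length-filter : ∀ {A : Set} {n} {P : Pred A 0ℓ} (P? : Decidable P) (f : Fin n → A) →
    + length (filter P? (tabulate f)) / 1 ≡ sum (λ k → if does (P? (f k)) then 1ℚ else 0ℚ)
  length-filter {n = zero} P? f = refl
  length-filter {n = suc n} P? f with does (P? (f zero))
  ... | true  = trans (/1-+ (+ 1) (+ length (filter P? (tabulate (f ∘ suc))))) (cong (λ x → 1ℚ + x) (length-filter P? (f ∘ suc)))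
  ... | false = trans (length-filter P? (f ∘ suc)) (sym (ℚ.+-identityˡ _))

  degree-sum : ∀ {m} (G : Graph m) i → + degree G i / 1 ≡ sum (adjacencyMatrix G i)
  degree-sum G i = length-filter (Graph.adj? G i) id

  -- Adjacent pairs agree in exactly one coordinate; for equal pairs the parameter
  -- -2 cancels the other two.
  adjacency-entry : ∀ n i j → adjacencyMatrix (complete n □ complete 2) i j ≡ pairMatrix n (- (1ℚ + 1ℚ)) 1ℚ 1ℚ 0ℚ i j
  adjacency-entry n i j
    with does (proj₁ (remQuot {n} 2 i) Fin.≟ proj₁ (remQuot {n} 2 j)) | does (proj₂ (remQuot {n} 2 i) Fin.≟ proj₂ (remQuot {n} 2 j))
  ... | true  | true  = refl
  ... | true  | false = refl
  ... | false | true  = refl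
  ... | false | false = refl

  degree-complete□ : ∀ n i → + degree (complete n □ complete 2) i / 1 ≡ n ⊠ 1ℚ
  degree-complete□ n i = begin
    + degree (complete n □ complete 2) i / 1
      ≡⟨ degree-sum (complete n □ complete 2) i ⟩
    sum (adjacencyMatrix (complete n □ complete 2) i)
      ≡⟨ sum-cong-≗ (λ k → trans (adjacency-entry n i k) (sym (ℚ.*-identityʳ _))) ⟩
    sum (λ k → entry (- (1ℚ + 1ℚ)) 1ℚ 1ℚ 0ℚ (v , u) (remQuot {n} 2 k) * 1ℚ)
      ≡⟨ action (- (1ℚ + 1ℚ)) 1ℚ 1ℚ 0ℚ v u (λ _ → 1ℚ) ⟩
    0ℚ + (1ℚ * sum {n} (λ _ → 1ℚ) + 0ℚ * sum {n} (λ _ → 1ℚ + 1ℚ))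
      ≡⟨ solve 2 (λ s t → con 0ℚ :+ (con 1ℚ :* s :+ con 0ℚ :* t) := s) refl (sum {n} (λ _ → 1ℚ)) (sum {n} (λ _ → 1ℚ + 1ℚ)) ⟩
    sum {n} (λ _ → 1ℚ)
      ≡⟨ trans (sum-const n 1ℚ) (ℚ.*-identityʳ _) ⟩
    n ⊠ 1ℚ ∎
    where
    open ℚ.+-*-Solver
    v = proj₁ (remQuot {n} 2 i)
    u = proj₂ (remQuot {n} 2 i)

  laplacian-entry : ∀ n → laplacian (complete n □ complete 2) ≐ pairMatrix n (n ⊠ 1ℚ + (1ℚ + 1ℚ)) (- 1ℚ) (- 1ℚ) 0ℚ
  laplacian-entry n i j = begin
    degreeMatrix (complete n □ complete 2) i j - adjacencyMatrix (complete n □ complete 2) i j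
      ≡⟨ cong₂ (λ b x → (if b then + degree (complete n □ complete 2) i / 1 else 0ℚ) - x) (does-≟-pair n i j) (adjacency-entry n i j) ⟩
    (if does (v Fin.≟ v′) ∧ does (u Fin.≟ u′) then + degree (complete n □ complete 2) i / 1 else 0ℚ) - pairMatrix n (- (1ℚ + 1ℚ)) 1ℚ 1ℚ 0ℚ i j
      ≡⟨ cong (λ N → (if does (v Fin.≟ v′) ∧ does (u Fin.≟ u′) then N else 0ℚ) - pairMatrix n (- (1ℚ + 1ℚ)) 1ℚ 1ℚ 0ℚ i j) (degree-complete□ n i) ⟩
    (if does (v Fin.≟ v′) ∧ does (u Fin.≟ u′) then n ⊠ 1ℚ else 0ℚ) - pairMatrix n (- (1ℚ + 1ℚ)) 1ℚ 1ℚ 0ℚ i j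
      ≡⟨ cong (_- pairMatrix n (- (1ℚ + 1ℚ)) 1ℚ 1ℚ 0ℚ i j) (if-∧ (does (v Fin.≟ v′)) (does (u Fin.≟ u′)) (n ⊠ 1ℚ)) ⟩
    (n ⊠ 1ℚ) * (δ v v′ * δ u u′) - pairMatrix n (- (1ℚ + 1ℚ)) 1ℚ 1ℚ 0ℚ i j
      ≡⟨ solve 3 (λ N e f → N :* (e :* f) :- (con (- (1ℚ + 1ℚ)) :* (e :* f) :+ con 1ℚ :* e :+ con 1ℚ :* f :+ con 0ℚ)
           := (N :+ con (1ℚ + 1ℚ)) :* (e :* f) :+ con (- 1ℚ) :* e :+ con (- 1ℚ) :* f :+ con 0ℚ) refl (n ⊠ 1ℚ) (δ v v′) (δ u u′) ⟩
    pairMatrix n (n ⊠ 1ℚ + (1ℚ + 1ℚ)) (- 1ℚ) (- 1ℚ) 0ℚ i j ∎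
    where
    open ℚ.+-*-Solver
    v = proj₁ (remQuot {n} 2 i)
    u = proj₂ (remQuot {n} 2 i)
    v′ = proj₁ (remQuot {n} 2 j)
    u′ = proj₂ (remQuot {n} 2 j)

    if-∧ : ∀ x y N → (if x ∧ y then N else 0ℚ) ≡ N * ((if x then 1ℚ else 0ℚ) * (if y then 1ℚ else 0ℚ))
    if-∧ true  true  N = sym (ℚ.*-identityʳ N)
    if-∧ true  false N = sym (ℚ.*-zeroʳ N)
    if-∧ false true  N = sym (ℚ.*-zeroʳ N)
    if-∧ false false N = sym (ℚ.*-zeroʳ N)

  δ-sym : ∀ {n} (i j : Fin n) → δ i j ≡ δ j i
  δ-sym zero    zero    = refl
  δ-sym zero    (suc j) = refl
  δ-sym (suc i) zero    = refl
  δ-sym (suc i) (suc j) = δ-sym i j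

  δ-refl : ∀ {n} (i : Fin n) → δ i i ≡ 1ℚ
  δ-refl zero    = refl
  δ-refl (suc i) = δ-refl i

  pairMatrix-symmetric : ∀ n a b c d → Symmetric (pairMatrix n a b c d)
  pairMatrix-symmetric n a b c d i j =
    cong₂ (λ e f → a * (e * f) + b * e + c * f + d)
      (δ-sym (proj₁ (remQuot {n} 2 j)) (proj₁ (remQuot {n} 2 i))) (δ-sym (proj₂ (remQuot {n} 2 j)) (proj₂ (remQuot {n} 2 i)))

  entry-cong : ∀ {n} {a a′ b b′ c c′ d d′} → a ≡ a′ → b ≡ b′ → c ≡ c′ → d ≡ d′ → (p q : Fin n × Fin 2) →
    entry a b c d p q ≡ entry a′ b′ c′ d′ p q
  entry-cong refl refl refl refl p q = refl

  -- The Moore–Penrose inverse of the Laplacian and the resistance distances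

  -- The Moore–Penrose inverse of the Laplacian has the parameters μ, β, γ and δ₀,
  -- where ν = 1/n and μ = 1/(n + 2). The value of δ₀ makes its row sums vanish.
  -- The lemmas b≡0, c≡0 and d≡κ evaluate what entry-product gives for L ⊗ L†.
  module Pseudoinverse (n : ℕ) (ν μ : ℚ) (Nν≡1 : (n ⊠ 1ℚ) * ν ≡ 1ℚ) (Nμ≡1 : (n ⊠ 1ℚ + (1ℚ + 1ℚ)) * μ ≡ 1ℚ) where
    open ℚ.+-*-Solver
    two N β γ κ δ₀ : ℚ
    two = + 2 / 1
    N = n ⊠ 1ℚ
    β = ν * μ
    γ = ½ * μ
    κ = - (½ * ν)
    δ₀ = κ * (μ + (β + β) + N * γ)

    -- The product L ⊗ L† is the projection I - J/(2n) along the all-ones vector.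
    L L† projection : Matrix ℚ (n ℕ.* 2) (n ℕ.* 2)
    L = laplacian (complete n □ complete 2)
    L† = pairMatrix n μ β γ δ₀
    projection = pairMatrix n 1ℚ 0ℚ 0ℚ κ

    b≡0 : (N + (1ℚ + 1ℚ)) * β + - 1ℚ * μ + (- 1ℚ * β + - 1ℚ * β) ≡ 0ℚ
    b≡0 = begin
      (N + (1ℚ + 1ℚ)) * β + - 1ℚ * μ + (- 1ℚ * β + - 1ℚ * β)
        ≡⟨ solve 3 (λ N ν μ → (N :+ con (1ℚ + 1ℚ)) :* (ν :* μ) :+ con (- 1ℚ) :* μ :+ (con (- 1ℚ) :* (ν :* μ) :+ con (- 1ℚ) :* (ν :* μ))
             := N :* ν :* μ :- μ) refl N ν μ ⟩
      N * ν * μ - μ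
        ≡⟨ cong (λ x → x * μ - μ) Nν≡1 ⟩
      1ℚ * μ - μ
        ≡⟨ solve 1 (λ μ → con 1ℚ :* μ :- μ := con 0ℚ) refl μ ⟩
      0ℚ ∎

    c≡0 : (N + (1ℚ + 1ℚ)) * γ + - 1ℚ * μ + N * (- 1ℚ * γ) ≡ 0ℚ
    c≡0 = solve 2 (λ N μ → (N :+ con (1ℚ + 1ℚ)) :* (con ½ :* μ) :+ con (- 1ℚ) :* μ :+ N :* (con (- 1ℚ) :* (con ½ :* μ)) := con 0ℚ) refl N μ

    d≡κ : (N + (1ℚ + 1ℚ)) * δ₀ + 0ℚ * μ + (- 1ℚ * γ + - 1ℚ * β) + (- 1ℚ * δ₀ + 0ℚ * β) + (- 1ℚ * δ₀ + 0ℚ * β)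
            + N * (- 1ℚ * δ₀ + 0ℚ * γ) + N * (0ℚ * δ₀ + 0ℚ * δ₀) ≡ κ
    d≡κ = begin
      (N + (1ℚ + 1ℚ)) * δ₀ + 0ℚ * μ + (- 1ℚ * γ + - 1ℚ * β) + (- 1ℚ * δ₀ + 0ℚ * β) + (- 1ℚ * δ₀ + 0ℚ * β)
            + N * (- 1ℚ * δ₀ + 0ℚ * γ) + N * (0ℚ * δ₀ + 0ℚ * δ₀)
        ≡⟨ solve 4 (λ N ν μ δ → (N :+ con (1ℚ + 1ℚ)) :* δ :+ con 0ℚ :* μ :+ (con (- 1ℚ) :* (con ½ :* μ) :+ con (- 1ℚ) :* (ν :* μ))
             :+ (con (- 1ℚ) :* δ :+ con 0ℚ :* (ν :* μ)) :+ (con (- 1ℚ) :* δ :+ con 0ℚ :* (ν :* μ))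
             :+ N :* (con (- 1ℚ) :* δ :+ con 0ℚ :* (con ½ :* μ)) :+ N :* (con 0ℚ :* δ :+ con 0ℚ :* δ)
             := :- (ν :* μ :+ con ½ :* (con 1ℚ :* μ))) refl N ν μ δ₀ ⟩
      - (ν * μ + ½ * (1ℚ * μ))
        ≡⟨ cong (λ x → - (ν * μ + ½ * (x * μ))) Nν≡1 ⟨
      - (ν * μ + ½ * (N * ν * μ))
        ≡⟨ solve 3 (λ N ν μ → :- (ν :* μ :+ con ½ :* (N :* ν :* μ)) := :- (con ½ :* ν :* ((N :+ con (1ℚ + 1ℚ)) :* μ))) refl N ν μ ⟩
      - (½ * ν * ((N + (1ℚ + 1ℚ)) * μ))
        ≡⟨ cong (λ x → - (½ * ν * x)) Nμ≡1 ⟩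
      - (½ * ν * 1ℚ)
        ≡⟨ cong -_ (ℚ.*-identityʳ (½ * ν)) ⟩
      κ ∎

    LL† : L ⊗ L† ≐ projection
    LL† i j = begin
      (L ⊗ L†) i j
        ≡⟨ ⊗-cong {B = L†} {L†} (laplacian-entry n) (λ _ _ → refl) i j ⟩
      (pairMatrix n (N + (1ℚ + 1ℚ)) (- 1ℚ) (- 1ℚ) 0ℚ ⊗ L†) i j
        ≡⟨ entry-product n (N + (1ℚ + 1ℚ)) (- 1ℚ) (- 1ℚ) 0ℚ μ β γ δ₀ (remQuot {n} 2 i) (remQuot {n} 2 j) ⟩
      _ ≡⟨ entry-cong Nμ≡1 b≡0 c≡0 d≡κ (remQuot {n} 2 i) (remQuot {n} 2 j) ⟩
      projection i j ∎

    L-symmetric : Symmetric L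
    L-symmetric i j = trans (laplacian-entry n j i)
      (trans (pairMatrix-symmetric n (N + (1ℚ + 1ℚ)) (- 1ℚ) (- 1ℚ) 0ℚ i j) (sym (laplacian-entry n i j)))

    projection-symmetric : Symmetric projection
    projection-symmetric = pairMatrix-symmetric n 1ℚ 0ℚ 0ℚ κ

    L†L : L† ⊗ L ≐ projection
    L†L i j = trans (⊗-swap L† L (pairMatrix-symmetric n μ β γ δ₀) L-symmetric i j)
      (trans (LL† j i) (projection-symmetric i j))

    -- The projection fixes a matrix whose row sums vanish; the hypothesis says this,
    -- since Nν = 1 and κ = -ν/2.
    projection-fixes : ∀ a b c d → κ * (a + (b + b) + N * c) + (d - N * ν * d) ≡ d →
      projection ⊗ pairMatrix n a b c d ≐ pairMatrix n a b c d
    projection-fixes a b c d fixed i j =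
      trans (entry-product n 1ℚ 0ℚ 0ℚ κ a b c d (remQuot {n} 2 i) (remQuot {n} 2 j))
        (entry-cong (ℚ.*-identityˡ a)
          (solve 2 (λ a b → con 1ℚ :* b :+ con 0ℚ :* a :+ (con 0ℚ :* b :+ con 0ℚ :* b) := b) refl a b)
          (solve 3 (λ a c N → con 1ℚ :* c :+ con 0ℚ :* a :+ N :* (con 0ℚ :* c) := c) refl a c N)
          (trans (solve 6 (λ N ν a b c d → let κ = :- (con ½ :* ν) in
              con 1ℚ :* d :+ κ :* a :+ (con 0ℚ :* c :+ con 0ℚ :* b) :+ (con 0ℚ :* d :+ κ :* b) :+ (con 0ℚ :* d :+ κ :* b)
                :+ N :* (con 0ℚ :* d :+ κ :* c) :+ N :* (κ :* d :+ κ :* d)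
              := κ :* (a :+ (b :+ b) :+ N :* c) :+ (d :- N :* ν :* d)) refl N ν a b c d) fixed)
          (remQuot {n} 2 i) (remQuot {n} 2 j))

    isMoorePenroseInverse : IsMoorePenroseInverse L L†
    isMoorePenroseInverse = record
      { AA†A≐A   = λ i j → begin
          (L ⊗ L† ⊗ L) i j
            ≡⟨ ⊗-cong {A′ = projection} {B = L} LL† (laplacian-entry n) i j ⟩
          (projection ⊗ pairMatrix n (N + (1ℚ + 1ℚ)) (- 1ℚ) (- 1ℚ) 0ℚ) i j
            ≡⟨ projection-fixes (N + (1ℚ + 1ℚ)) (- 1ℚ) (- 1ℚ) 0ℚ (solve 2 (λ N ν → (:- (con ½ :* ν)) :* ((N :+ con (1ℚ + 1ℚ)) :+ (con (- 1ℚ) :+ con (- 1ℚ)) :+ N :* con (- 1ℚ))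
                 :+ (con 0ℚ :- N :* ν :* con 0ℚ) := con 0ℚ) refl N ν) i j ⟩
          pairMatrix n (N + (1ℚ + 1ℚ)) (- 1ℚ) (- 1ℚ) 0ℚ i j
            ≡⟨ laplacian-entry n i j ⟨
          L i j ∎
      ; A†AA†≐A† = λ i j → trans (⊗-cong {A′ = projection} {L†} {L†} L†L (λ _ _ → refl) i j)
          (projection-fixes μ β γ δ₀ (begin
            δ₀ + (δ₀ - N * ν * δ₀)  ≡⟨ cong (λ x → δ₀ + (δ₀ - x * δ₀)) Nν≡1 ⟩
            δ₀ + (δ₀ - 1ℚ * δ₀)     ≡⟨ solve 1 (λ d → d :+ (d :- con 1ℚ :* d) := d) refl δ₀ ⟩
            δ₀                      ∎) i j)
      ; AA†-symm = λ i j → trans (LL† j i) (trans (projection-symmetric i j) (sym (LL† i j)))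
      ; A†A-symm = λ i j → trans (L†L j i) (trans (projection-symmetric i j) (sym (L†L i j)))
      }

    L†-diagonal : ∀ i → L† i i ≡ μ + β + γ + δ₀
    L†-diagonal i = begin
      L† i i
        ≡⟨ cong₂ (λ e f → μ * (e * f) + β * e + γ * f + δ₀) (δ-refl (proj₁ (remQuot {n} 2 i))) (δ-refl (proj₂ (remQuot {n} 2 i))) ⟩
      μ * 1ℚ + β * 1ℚ + γ * 1ℚ + δ₀
        ≡⟨ cong (_+ δ₀) (cong₂ _+_ (cong₂ _+_ (ℚ.*-identityʳ μ) (ℚ.*-identityʳ β)) (ℚ.*-identityʳ γ)) ⟩
      μ + β + γ + δ₀ ∎

    -- The diagonal entries of L† are all μ + β + γ + δ₀, and δ₀ cancels in the
    -- resistance distances.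
    -resistance : ∀ {G} → IsMoorePenroseInverse L G → ∀ i j →
      - resistanceDistanceMatrix G i j ≡ pairMatrix n (two * μ) (two * β) (two * γ) (- (two * (μ + β + γ))) i j
    -resistance {G} isMP i j = begin
      - (G i i + G j j - two * G i j)
        ≡⟨ cong -_ (cong₂ _-_ (cong₂ _+_ (trans (G≐ i i) (L†-diagonal i)) (trans (G≐ j j) (L†-diagonal j))) (cong (two *_) (G≐ i j))) ⟩
      - (μ + β + γ + δ₀ + (μ + β + γ + δ₀) - two * L† i j)
        ≡⟨ solve 6 (λ a b c d e f → :- (a :+ b :+ c :+ d :+ (a :+ b :+ c :+ d) :- con two :* (a :* (e :* f) :+ b :* e :+ c :* f :+ d))
             := con two :* a :* (e :* f) :+ con two :* b :* e :+ con two :* c :* f :+ :- (con two :* (a :+ b :+ c)))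
             refl μ β γ δ₀ (δ (proj₁ (remQuot {n} 2 i)) (proj₁ (remQuot {n} 2 j))) (δ (proj₂ (remQuot {n} 2 i)) (proj₂ (remQuot {n} 2 j))) ⟩
      pairMatrix n (two * μ) (two * β) (two * γ) (- (two * (μ + β + γ))) i j ∎
      where
      G≐ : G ≐ L†
      G≐ = moorePenrose-unique isMoorePenroseInverse isMP

    -- The eigenvalues of -R, from its parameters: 1 for the indicator of u = 1
    -- modulo the all-ones vector, 2ν for the vector (1 , 1) of a block, and the row
    -- sum. The remaining one is two * μ itself. The factors 1ℚ inserted in the proofs
    -- mark where N * ν is to be put.
    eigenvalue-t : two * μ + N * (two * γ) ≡ 1ℚ
    eigenvalue-t = trans (solve 2 (λ N μ → con two :* μ :+ N :* (con two :* (con ½ :* μ)) := (N :+ con (1ℚ + 1ℚ)) :* μ) refl N μ) Nμ≡1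

    eigenvalue-p : two * μ + (two * β + two * β) ≡ two * ν
    eigenvalue-p = begin
      two * μ + (two * β + two * β)
        ≡⟨ solve 2 (λ ν μ → con two :* μ :+ (con two :* (ν :* μ) :+ con two :* (ν :* μ)) := con two :* (con 1ℚ :* μ :+ con two :* ν :* μ)) refl ν μ ⟩
      two * (1ℚ * μ + two * ν * μ)
        ≡⟨ cong (λ x → two * (x * μ + two * ν * μ)) Nν≡1 ⟨
      two * (N * ν * μ + two * ν * μ)
        ≡⟨ solve 3 (λ N ν μ → con two :* (N :* ν :* μ :+ con two :* ν :* μ) := con two :* (ν :* ((N :+ con (1ℚ + 1ℚ)) :* μ))) refl N ν μ ⟩
      two * (ν * ((N + (1ℚ + 1ℚ)) * μ))
        ≡⟨ cong (λ x → two * (ν * x)) Nμ≡1 ⟩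
      two * (ν * 1ℚ)
        ≡⟨ cong (two *_) (ℚ.*-identityʳ ν) ⟩
      two * ν ∎

    eigenvalue-s : two * μ + (two * β + two * β) + N * (two * γ) + (N * - (two * (μ + β + γ)) + N * - (two * (μ + β + γ)))
      ≡ - ((+ 5 / 1 * N * N + two * N - + 4 / 1) * (ν * μ))
    eigenvalue-s = begin
      two * μ + (two * β + two * β) + N * (two * γ) + (N * - (two * (μ + β + γ)) + N * - (two * (μ + β + γ)))
        ≡⟨ solve 3 (λ N ν μ → let β = ν :* μ; γ = con ½ :* μ; d = :- (con two :* (μ :+ β :+ γ)) in
             con two :* μ :+ (con two :* β :+ con two :* β) :+ N :* (con two :* γ) :+ (N :* d :+ N :* d)
             := :- (con (+ 5 / 1) :* N :* con 1ℚ :* μ :- con two :* con 1ℚ :* μ :+ con (+ 4 / 1) :* (N :* ν) :* μ :- con (+ 4 / 1) :* (ν :* μ))) refl N ν μ ⟩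
      - (+ 5 / 1 * N * 1ℚ * μ - two * 1ℚ * μ + + 4 / 1 * (N * ν) * μ - + 4 / 1 * (ν * μ))
        ≡⟨ cong (λ x → - (+ 5 / 1 * N * x * μ - two * x * μ + + 4 / 1 * (N * ν) * μ - + 4 / 1 * (ν * μ))) Nν≡1 ⟨
      - (+ 5 / 1 * N * (N * ν) * μ - two * (N * ν) * μ + + 4 / 1 * (N * ν) * μ - + 4 / 1 * (ν * μ))
        ≡⟨ solve 3 (λ N ν μ → :- (con (+ 5 / 1) :* N :* (N :* ν) :* μ :- con two :* (N :* ν) :* μ :+ con (+ 4 / 1) :* (N :* ν) :* μ :- con (+ 4 / 1) :* (ν :* μ))
             := :- ((con (+ 5 / 1) :* N :* N :+ con two :* N :- con (+ 4 / 1)) :* (ν :* μ))) refl N ν μ ⟩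
      - ((+ 5 / 1 * N * N + two * N - + 4 / 1) * (ν * μ)) ∎

-- The eigenvalues

open import Data.Integer using (+_) renaming (_-_ to _-ℤ_)
open import Data.Nat using (_+_; _*_; _∸_)
open import Data.Rational using (-_)

open RationalMatrices

-- The eigenvalues as fractions, in terms of N = n, ν = 1/n and μ = 1/(n + 2).
module Reciprocals (n : ℕ) .{{_ : NonZero n}} where
  open import Data.Rational using () renaming (_+_ to _+ℚ_; _*_ to _*ℚ_; _-_ to _-ℚ_)
  open import Relation.Binary.PropositionalEquality
    using (refl; sym; trans; cong; cong₂; module ≡-Reasoning)
  open import Algebra.Properties.Semiring.Mult (CommutativeRing.semiring ℚ.+-*-commutativeRing)
    using () renaming (_×_ to _⊠_)
  open ≡-Reasoning

  instance nz = m*n≢0 n (2 + n)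
  open ℚ.+-*-Solver
  N ν μ : ℚ
  N = n ⊠ 1ℚ
  ν = + 1 / n
  μ = + 1 / (2 + n)

  Nν≡1 : N *ℚ ν ≡ 1ℚ
  Nν≡1 = trans (ℚ.*-comm N ν) (trans (cong (ν *ℚ_) (×1≡/1 n)) (/-cancel (+ 1) n))

  2+N≡ : N +ℚ (1ℚ +ℚ 1ℚ) ≡ + (2 + n) / 1
  2+N≡ = trans (solve 1 (λ N → N :+ con (1ℚ +ℚ 1ℚ) := con 1ℚ :+ (con 1ℚ :+ N)) refl N) (×1≡/1 (2 + n))

  Nμ≡1 : (N +ℚ (1ℚ +ℚ 1ℚ)) *ℚ μ ≡ 1ℚ
  Nμ≡1 = trans (ℚ.*-comm _ μ) (trans (cong (μ *ℚ_) 2+N≡) (/-cancel (+ 1) (2 + n)))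

  2/n : + 2 / n ≡ (+ 2 / 1) *ℚ ν
  2/n = /-inverse (+ 2) n ν (trans (cong (_*ℚ ν) (sym (×1≡/1 n))) Nν≡1)

  2/2+n : + 2 / (2 + n) ≡ (+ 2 / 1) *ℚ μ
  2/2+n = /-inverse (+ 2) (2 + n) μ (trans (cong (_*ℚ μ) (sym 2+N≡)) Nμ≡1)

  denominator : (+ (n * (2 + n)) / 1) *ℚ (ν *ℚ μ) ≡ 1ℚ
  denominator = begin
    (+ (n * (2 + n)) / 1) *ℚ (ν *ℚ μ)
      ≡⟨ cong (λ k → (k / 1) *ℚ (ν *ℚ μ)) (ℤ.pos-* n (2 + n)) ⟩
    ((+ n ℤ.* + (2 + n)) / 1) *ℚ (ν *ℚ μ)
      ≡⟨ cong (_*ℚ (ν *ℚ μ)) (trans (/1-* (+ n) (+ (2 + n))) (cong₂ _*ℚ_ (sym (×1≡/1 n)) (sym 2+N≡))) ⟩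
    N *ℚ (N +ℚ (1ℚ +ℚ 1ℚ)) *ℚ (ν *ℚ μ)
      ≡⟨ solve 4 (λ N M ν μ → N :* M :* (ν :* μ) := N :* ν :* (M :* μ)) refl N (N +ℚ (1ℚ +ℚ 1ℚ)) ν μ ⟩
    N *ℚ ν *ℚ ((N +ℚ (1ℚ +ℚ 1ℚ)) *ℚ μ)
      ≡⟨ cong₂ _*ℚ_ Nν≡1 Nμ≡1 ⟩
    1ℚ ∎

  numerator : (+ (5 * n * n + 2 * n) -ℤ + 4) / 1 ≡ (+ 5 / 1) *ℚ N *ℚ N +ℚ (+ 2 / 1) *ℚ N -ℚ (+ 4 / 1)
  numerator = trans (/1-+ (+ (5 * n * n + 2 * n)) (ℤ.- + 4))
    (cong (_-ℚ (+ 4 / 1)) (trans (/1-+ (+ (5 * n * n)) (+ (2 * n)))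
      (cong₂ _+ℚ_ (trans (cast-* (5 * n) n) (cong₂ _*ℚ_ (trans (cast-* 5 n) (cong ((+ 5 / 1) *ℚ_) cast-n)) cast-n))
                  (trans (cast-* 2 n) (cong ((+ 2 / 1) *ℚ_) cast-n)))))
    where
    cast-* : ∀ k l → + (k * l) / 1 ≡ (+ k / 1) *ℚ (+ l / 1)
    cast-* k l = trans (cong (_/ 1) (ℤ.pos-* k l)) (/1-* (+ k) (+ l))

    cast-n : + n / 1 ≡ N
    cast-n = sym (×1≡/1 n)

  largest : (+ (5 * n * n + 2 * n) -ℤ + 4) / (n * (2 + n))
    ≡ ((+ 5 / 1) *ℚ N *ℚ N +ℚ (+ 2 / 1) *ℚ N -ℚ (+ 4 / 1)) *ℚ (ν *ℚ μ)
  largest = trans (/-inverse (+ (5 * n * n + 2 * n) -ℤ + 4) (n * (2 + n)) (ν *ℚ μ) denominator) (cong (_*ℚ (ν *ℚ μ)) numerator)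

  neg-neg : ∀ x → - (- x) ≡ x
  neg-neg x = solve 1 (λ x → :- (:- x) := x) refl x

theorem5p3 : (n : ℕ) .{{_ : NonZero n}} →
    let L = laplacian (complete n □ complete 2)
        instance nz = m*n≢0 n (2 + n)
    in
    ∃ (λ L† → IsMoorePenroseInverse L L†)
    × (∀ L† → IsMoorePenroseInverse L L† →
        HasEigenvalues (resistanceDistanceMatrix L†)
          ( (+ (5 * n * n + 2 * n) -ℤ + 4) / (n * (2 + n))
          ∷ replicate (n ∸ 1) (- (+ 2 / n))
          ++ - 1ℚ
          ∷ replicate (n ∸ 1) (- (+ 2 / (2 + n)))))
theorem5p3 (suc m) =
  (P.L† , P.isMoorePenroseInverse) , λ L† isMP →
    det-charMatrix m (P.two ℚ.* μ) (P.two ℚ.* P.β) (P.two ℚ.* P.γ) (- (P.two ℚ.* (μ ℚ.+ P.β ℚ.+ P.γ)))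
      {A = resistanceDistanceMatrix L†} (P.-resistance isMP)
      (≡.trans (≡.cong -_ largest) (≡.sym P.eigenvalue-s))
      (≡.sym P.eigenvalue-t)
      (≡.trans (neg-neg (+ 2 / suc m)) (≡.trans 2/n (≡.sym P.eigenvalue-p)))
      (≡.trans (neg-neg (+ 2 / (2 + suc m))) 2/2+n)
  where
  open Reciprocals (suc m)
  module P = Pseudoinverse (suc m) ν μ Nν≡1 Nμ≡1
  open CharacteristicPolynomial Polynomials.polyRing X constₚ
    Polynomials.const-0 (λ _ → ≡.refl) (λ _ _ _ → ≡.refl) Polynomials.const-*
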